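{- IncMax admits a $1.772$-competitive randomized algorithm; that is, for every instance $(U,f)$ of IncMax there is a randomized solution $\Sigma=(E_1,E_2,\dots)$ with $\mathrm{Opt}(k)\le 1.772\cdot\mathbb{E}[f(\{E_1,\dots,E_k\})]$ for all $k$.
   Context: IncMax. An instance is given by a countable set $U$ of elements and a monotone function $f:2^U\to\mathbb{R}_{\ge 0}$ (i.e. $f(X)\le f(Y)$ for $X\subseteq Y$) that is accountable: for every (finite non-empty) $X\subseteq U$ there exists $e\in X$ with $f(X\setminus\{e\})\ge f(X)-f(X)/|X|$. For $k\le n:=|U|$ (all $k\in\mathbb{N}$ if $U$ is infinite) let $\mathrm{Opt}(k)=\max\{f(X): X\subseteq U,\ |X|=k\}$ (assumed to exist). A deterministic solution is an order $\sigma=(e_1,e_2,\dots)$ of the elements of $U$. A randomized solution is a probability distribution $\Sigma=(E_1,E_2,\dots)$ over deterministic solutions ($E_1,E_2,\dots$ are random variables); it is $\alpha$-competitive if $\mathrm{Opt}(k)\le\alpha\,\mathbb{E}[f(\{E_1,\dots,E_k\})]$ for all $k$. A randomized algorithm is $\alpha$-competitive if it produces an $\alpha$-competitive randomized solution for every instance. -}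

module Defs where

open import Data.Bool using (Bool; true; T; not; _∧_; _∨_)
open import Data.Fin as Fin using (Fin)
import Data.Fin.Properties as Fin
open import Data.Integer using (+_)
open import Data.Nat as ℕ using (ℕ; zero; suc)
import Data.Nat.Properties as ℕ
open import Data.Product using (∃; _×_; _,_)
open import Data.Rational as ℚ using (ℚ; 0ℚ; 1ℚ; ½; ∣_∣; _/_)
import Data.Rational.Properties as ℚ
open import Data.Rational.Solver using (module +-*-Solver)
open import Data.Unit using (⊤)
open import Function using (_↔_; _⇔_; Inverse; const; _∘_)
open import Function.Properties.Inverse using (Inverse⇒Injection)
open import Relation.Binary.Definitions using (DecidableEquality)
open import Relation.Binary.PropositionalEquality
  using (_≡_; refl; sym; trans; cong; subst)
open import Relation.Nullary.Decidable using (⌊_⌋; via-injection)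

------------------------------------------------------------------------
-- Real numbers, as Cauchy sequences of rationals with a modulus, taken
-- up to _≈_

IsCauchy : (ℕ → ℚ) → Set
IsCauchy x = ∀ ε → 0ℚ ℚ.< ε →
  ∃ λ N → ∀ m n → N ℕ.≤ m → N ℕ.≤ n → ∣ x m ℚ.- x n ∣ ℚ.≤ ε

record ℝ : Set where
  constructor mkℝ
  field
    seq    : ℕ → ℚ
    cauchy : IsCauchy seq

open ℝ

infix  4 _≤ᴿ_ _≈_

_≤ᴿ_ : ℝ → ℝ → Set
x ≤ᴿ y = ∀ ε → 0ℚ ℚ.< ε →
  ∃ λ N → ∀ n → N ℕ.≤ n → seq x n ℚ.≤ seq y n ℚ.+ ε

_≈_ : ℝ → ℝ → Set
x ≈ y = x ≤ᴿ y × y ≤ᴿ x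

private
  -- Without abstract, checking the records below unfolds these proofs and does
  -- not terminate in reasonable time.
  abstract
    0<½*ε : ∀ {ε} → 0ℚ ℚ.< ε → 0ℚ ℚ.< ½ ℚ.* ε
    0<½*ε 0<ε = ℚ.*-monoʳ-<-pos ½ 0<ε

    ½+½ : ∀ ε → ½ ℚ.* ε ℚ.+ ½ ℚ.* ε ≡ ε
    ½+½ ε = trans (sym (ℚ.*-distribʳ-+ ε ½ ½)) (ℚ.*-identityˡ ε)

    module _ where
      open +-*-Solver

      +-rearrange : ∀ a b c d →
        (a ℚ.+ b) ℚ.- (c ℚ.+ d) ≡ (a ℚ.- c) ℚ.+ (b ℚ.- d)
      +-rearrange = solve 4 (λ a b c d →
        (a :+ b) :- (c :+ d) := (a :- c) :+ (b :- d)) refl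

      neg-rearrange : ∀ a b → (ℚ.- a) ℚ.- (ℚ.- b) ≡ ℚ.- (a ℚ.- b)
      neg-rearrange = solve 2 (λ a b → (:- a) :- (:- b) := :- (a :- b)) refl

      *-rearrange : ∀ a b c d →
        a ℚ.* b ℚ.- c ℚ.* d ≡ a ℚ.* (b ℚ.- d) ℚ.+ d ℚ.* (a ℚ.- c)
      *-rearrange = solve 4 (λ a b c d →
        a :* b :- c :* d := a :* (b :- d) :+ d :* (a :- c)) refl

      split : ∀ a b → a ≡ b ℚ.+ (a ℚ.- b)
      split = solve 2 (λ a b → a := b :+ (a :- b)) refl

    cauchy-const : ∀ q → IsCauchy (const q)
    cauchy-const q ε 0<ε = 0 , λ _ _ _ _ →
      subst (ℚ._≤ ε) (sym (cong ∣_∣ (ℚ.+-inverseʳ q))) (ℚ.<⇒≤ 0<ε)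

    cauchy-+ : ∀ x y → IsCauchy x → IsCauchy y → IsCauchy (λ n → x n ℚ.+ y n)
    cauchy-+ x y cx cy ε 0<ε
      with cx (½ ℚ.* ε) (0<½*ε 0<ε) | cy (½ ℚ.* ε) (0<½*ε 0<ε)
    ... | M , hx | N , hy = M ℕ.⊔ N , λ m n p q → begin
      ∣ (x m ℚ.+ y m) ℚ.- (x n ℚ.+ y n) ∣
        ≡⟨ cong ∣_∣ (+-rearrange (x m) (y m) (x n) (y n)) ⟩
      ∣ (x m ℚ.- x n) ℚ.+ (y m ℚ.- y n) ∣
        ≤⟨ ℚ.∣p+q∣≤∣p∣+∣q∣ (x m ℚ.- x n) (y m ℚ.- y n) ⟩
      ∣ x m ℚ.- x n ∣ ℚ.+ ∣ y m ℚ.- y n ∣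
        ≤⟨ ℚ.+-mono-≤ (hx m n (ℕ.m⊔n≤o⇒m≤o M N p) (ℕ.m⊔n≤o⇒m≤o M N q))
                      (hy m n (ℕ.m⊔n≤o⇒n≤o M N p) (ℕ.m⊔n≤o⇒n≤o M N q)) ⟩
      ½ ℚ.* ε ℚ.+ ½ ℚ.* ε
        ≡⟨ ½+½ ε ⟩
      ε ∎
      where open ℚ.≤-Reasoning

    cauchy-neg : ∀ x → IsCauchy x → IsCauchy (λ n → ℚ.- x n)
    cauchy-neg x cx ε 0<ε with cx ε 0<ε
    ... | N , h = N , λ m n p q →
      subst (ℚ._≤ ε)
        (sym (trans (cong ∣_∣ (neg-rearrange (x m) (x n))) (ℚ.∣-p∣≡∣p∣ (x m ℚ.- x n))))
        (h m n p q)

    tail-bound : ∀ {x} → IsCauchy x →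
      ∃ λ B → 0ℚ ℚ.< B × ∃ λ N → ∀ n → N ℕ.≤ n → ∣ x n ∣ ℚ.≤ B
    tail-bound {x} cx with cx 1ℚ (ℚ.positive⁻¹ 1ℚ)
    ... | N , h =
        ∣ x N ∣ ℚ.+ 1ℚ
      , ℚ.+-mono-≤-< (ℚ.0≤∣p∣ (x N)) (ℚ.positive⁻¹ 1ℚ)
      , N , λ n p → begin
      ∣ x n ∣                        ≡⟨ cong ∣_∣ (split (x n) (x N)) ⟩
      ∣ x N ℚ.+ (x n ℚ.- x N) ∣      ≤⟨ ℚ.∣p+q∣≤∣p∣+∣q∣ (x N) (x n ℚ.- x N) ⟩
      ∣ x N ∣ ℚ.+ ∣ x n ℚ.- x N ∣    ≤⟨ ℚ.+-monoʳ-≤ ∣ x N ∣ (h n N p ℕ.≤-refl) ⟩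
      ∣ x N ∣ ℚ.+ 1ℚ                 ∎
      where open ℚ.≤-Reasoning

    ∣*∣-mono : ∀ p q {B δ} → 0ℚ ℚ.< δ → ∣ p ∣ ℚ.≤ B → ∣ q ∣ ℚ.≤ δ →
      ∣ p ℚ.* q ∣ ℚ.≤ B ℚ.* δ
    ∣*∣-mono p q {B} {δ} 0<δ p≤B q≤δ = begin
      ∣ p ℚ.* q ∣        ≡⟨ ℚ.∣p*q∣≡∣p∣*∣q∣ p q ⟩
      ∣ p ∣ ℚ.* ∣ q ∣    ≤⟨ ℚ.*-monoˡ-≤-nonNeg ∣ p ∣ {{ℚ.nonNegative (ℚ.0≤∣p∣ p)}} q≤δ ⟩
      ∣ p ∣ ℚ.* δ        ≤⟨ ℚ.*-monoʳ-≤-nonNeg δ {{ℚ.nonNegative (ℚ.<⇒≤ 0<δ)}} p≤B ⟩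
      B ℚ.* δ            ∎
      where open ℚ.≤-Reasoning

    quotient : ∀ B ε → 0ℚ ℚ.< B → 0ℚ ℚ.< ε → ∃ λ δ → 0ℚ ℚ.< δ × B ℚ.* δ ≡ ε
    quotient B ε 0<B 0<ε =
        B⁻¹ ℚ.* ε
      , subst (ℚ._< B⁻¹ ℚ.* ε) (ℚ.*-zeroʳ B⁻¹) (ℚ.*-monoʳ-<-pos B⁻¹ {{ℚ.1/pos⇒pos B}} 0<ε)
      , trans (sym (ℚ.*-assoc B B⁻¹ ε))
          (trans (cong (ℚ._* ε) (ℚ.*-inverseʳ B)) (ℚ.*-identityˡ ε))
      where
      instance
        B-pos : ℚ.Positive B
        B-pos = ℚ.positive 0<B
        B-nonZero : ℚ.NonZero B
        B-nonZero = ℚ.pos⇒nonZero B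
      B⁻¹ : ℚ
      B⁻¹ = ℚ.1/ B

    *-close : ∀ a b c d {B C δ} → 0ℚ ℚ.< δ → ∣ a ∣ ℚ.≤ B → ∣ d ∣ ℚ.≤ C →
      ∣ a ℚ.- c ∣ ℚ.≤ δ → ∣ b ℚ.- d ∣ ℚ.≤ δ →
      ∣ a ℚ.* b ℚ.- c ℚ.* d ∣ ℚ.≤ (B ℚ.+ C) ℚ.* δ
    *-close a b c d {B} {C} {δ} 0<δ a≤B d≤C a-c≤δ b-d≤δ = begin
      ∣ a ℚ.* b ℚ.- c ℚ.* d ∣
        ≡⟨ cong ∣_∣ (*-rearrange a b c d) ⟩
      ∣ a ℚ.* (b ℚ.- d) ℚ.+ d ℚ.* (a ℚ.- c) ∣
        ≤⟨ ℚ.∣p+q∣≤∣p∣+∣q∣ (a ℚ.* (b ℚ.- d)) (d ℚ.* (a ℚ.- c)) ⟩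
      ∣ a ℚ.* (b ℚ.- d) ∣ ℚ.+ ∣ d ℚ.* (a ℚ.- c) ∣
        ≤⟨ ℚ.+-mono-≤ (∣*∣-mono a (b ℚ.- d) 0<δ a≤B b-d≤δ)
                      (∣*∣-mono d (a ℚ.- c) 0<δ d≤C a-c≤δ) ⟩
      B ℚ.* δ ℚ.+ C ℚ.* δ
        ≡⟨ sym (ℚ.*-distribʳ-+ δ B C) ⟩
      (B ℚ.+ C) ℚ.* δ ∎
      where open ℚ.≤-Reasoning

    cauchy-* : ∀ x y → IsCauchy x → IsCauchy y → IsCauchy (λ n → x n ℚ.* y n)
    cauchy-* x y cx cy ε 0<ε =
      let (B , 0<B , K , bx)      = tail-bound cx
          (C , 0<C , L , by)      = tail-bound cy
          (δ , 0<δ , [B+C]δ≡ε)    = quotient (B ℚ.+ C) ε (ℚ.+-mono-< 0<B 0<C) 0<ε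
          (M , hx)                = cx δ 0<δ
          (N , hy)                = cy δ 0<δ
      in (K ℕ.+ L) ℕ.+ (M ℕ.+ N) , λ m n p q →
        subst (∣ x m ℚ.* y m ℚ.- x n ℚ.* y n ∣ ℚ.≤_) [B+C]δ≡ε
          (*-close (x m) (y m) (x n) (y n) 0<δ
            (bx m (ℕ.m+n≤o⇒m≤o K (ℕ.m+n≤o⇒m≤o (K ℕ.+ L) p)))
            (by n (ℕ.m+n≤o⇒n≤o K (ℕ.m+n≤o⇒m≤o (K ℕ.+ L) q)))
            (hx m n (ℕ.m+n≤o⇒m≤o M (ℕ.m+n≤o⇒n≤o (K ℕ.+ L) p))
                    (ℕ.m+n≤o⇒m≤o M (ℕ.m+n≤o⇒n≤o (K ℕ.+ L) q)))
            (hy m n (ℕ.m+n≤o⇒n≤o M (ℕ.m+n≤o⇒n≤o (K ℕ.+ L) p))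
                    (ℕ.m+n≤o⇒n≤o M (ℕ.m+n≤o⇒n≤o (K ℕ.+ L) q))))

fromℚ : ℚ → ℝ
fromℚ q = mkℝ (const q) (cauchy-const q)

0ᴿ 1ᴿ : ℝ
0ᴿ = fromℚ 0ℚ
1ᴿ = fromℚ 1ℚ

infixl 6 _+ᴿ_ _-ᴿ_
infixl 7 _*ᴿ_

_+ᴿ_ _-ᴿ_ _*ᴿ_ : ℝ → ℝ → ℝ
x +ᴿ y = mkℝ (λ n → seq x n ℚ.+ seq y n)
             (cauchy-+ (seq x) (seq y) (cauchy x) (cauchy y))
x -ᴿ y = mkℝ (λ n → seq x n ℚ.- seq y n)
             (cauchy-+ (seq x) (λ n → ℚ.- seq y n)
               (cauchy x) (cauchy-neg (seq y) (cauchy y)))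
x *ᴿ y = mkℝ (λ n → seq x n ℚ.* seq y n)
             (cauchy-* (seq x) (seq y) (cauchy x) (cauchy y))

partialSum : (ℕ → ℝ) → ℕ → ℝ
partialSum a zero    = 0ᴿ
partialSum a (suc n) = partialSum a n +ᴿ a n

HasSum : (ℕ → ℝ) → ℝ → Set
HasSum a s = ∀ ε → 0ℚ ℚ.< ε → ∃ λ N → ∀ n → N ℕ.≤ n →
  (partialSum a n ≤ᴿ s +ᴿ fromℚ ε) × (s ≤ᴿ partialSum a n +ᴿ fromℚ ε)

------------------------------------------------------------------------
-- Subsets

𝒫 : Set → Set
𝒫 A = A → Bool

infix 4 _∈_ _⊆_

_∈_ : {A : Set} → A → 𝒫 A → Set
a ∈ X = T (X a)

_⊆_ : {A : Set} → 𝒫 A → 𝒫 A → Set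
X ⊆ Y = ∀ a → a ∈ X → a ∈ Y

HasCardinality : {A : Set} → 𝒫 A → ℕ → Set
HasCardinality X k = Fin k ↔ ∃ λ a → a ∈ X

Disjoint : {A : Set} → (ℕ → 𝒫 A) → Set
Disjoint X = ∀ m n a → a ∈ X m → a ∈ X n → m ≡ n

IsUnion : {A : Set} → (ℕ → 𝒫 A) → 𝒫 A → Set
IsUnion X Y = ∀ a → a ∈ Y ⇔ ∃ λ n → a ∈ X n

------------------------------------------------------------------------
-- Probability

-- The events are only required to form an algebra, and σ-additivity is
-- required of those countable disjoint unions that are events.  A σ-algebra
-- with a probability measure is a special case; conversely, Carathéodory's
-- theorem extends ℙ uniquely to a probability measure on the generated
-- σ-algebra.  Constructively, closure under all countable unions would exclude
-- even a fair coin, since such a union of decidable sets need not be decidable.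
record Probability (Ω : Set) : Set₁ where
  field
    Event      : 𝒫 Ω → Set
    event-full : Event (const true)
    event-∁    : ∀ {A} → Event A → Event (not ∘ A)
    event-∪    : ∀ {A B} → Event A → Event B → Event (λ ω → A ω ∨ B ω)
    ℙ          : ∀ {A} → Event A → ℝ
    ℙ-nonNeg   : ∀ {A} (a : Event A) → 0ᴿ ≤ᴿ ℙ a
    ℙ-full     : ℙ event-full ≈ 1ᴿ
    ℙ-additive : ∀ {A : ℕ → 𝒫 Ω} {B} (a : ∀ n → Event (A n)) (b : Event B) →
                 Disjoint A → IsUnion A B → HasSum (λ n → ℙ (a n)) (ℙ b)

-- 𝔼[ X ] = v for a non-negative X that takes, almost surely, only countably
-- many values.  By non-negativity v depends neither on the choice of the
-- pieces nor on their order.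
record IsExpectation {Ω : Set} (μ : Probability Ω) (X : Ω → ℝ) (v : ℝ) : Set where
  open Probability μ
  field
    piece    : ℕ → 𝒫 Ω
    event    : ∀ n → Event (piece n)
    disjoint : Disjoint piece
    covers   : HasSum (λ n → ℙ (event n)) 1ᴿ
    value    : ℕ → ℝ
    constant : ∀ n ω → ω ∈ piece n → X ω ≈ value n
    sum      : HasSum (λ n → value n *ᴿ ℙ (event n)) v

------------------------------------------------------------------------
-- Incremental maximization

data Size : Set where
  finite   : ℕ → Size
  infinite : Size

_≤ˢ_ : ℕ → Size → Set
k ≤ˢ finite n = k ℕ.≤ n
k ≤ˢ infinite = ⊤

Position : Size → Set
Position (finite n) = Fin n
Position infinite   = ℕ

index : ∀ s → Position s → ℕ
index (finite n) i = Fin.toℕ i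
index infinite   i = i

position-≟ : ∀ s → DecidableEquality (Position s)
position-≟ (finite n) = Fin._≟_
position-≟ infinite   = ℕ._≟_

record Instance : Set₁ where
  field
    U         : Set
    size      : Size
    countable : U ↔ Position size

  _≟_ : DecidableEquality U
  _≟_ = via-injection (Inverse⇒Injection countable) (position-≟ size)

  _∖_ : 𝒫 U → U → 𝒫 U
  (X ∖ e) u = X u ∧ not ⌊ u ≟ e ⌋

  field
    f           : 𝒫 U → ℝ
    nonNegative : ∀ X → 0ᴿ ≤ᴿ f X
    monotone    : ∀ X Y → X ⊆ Y → f X ≤ᴿ f Y
    accountable : ∀ X m → HasCardinality X (suc m) →
                  ∃ λ e → e ∈ X × f X -ᴿ fromℚ (+ 1 / suc m) *ᴿ f X ≤ᴿ f (X ∖ e)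
    optimum     : ∀ k → k ≤ˢ size → ∃ λ X → HasCardinality X k ×
                  (∀ Y → HasCardinality Y k → f Y ≤ᴿ f X)

  Opt : ∀ k → k ≤ˢ size → ℝ
  Opt k k≤n = let (X , _) = optimum k k≤n in f X

  -- (e₁ , e₂ , …) with eᵢ₊₁ at position i
  Order : Set
  Order = Position size ↔ U

  -- {e₁ , … , eₖ}
  firstElements : Order → ℕ → 𝒫 U
  firstElements σ k u = index size (Inverse.from σ u) ℕ.<ᵇ k

  -- That each Eᵢ is a random variable with values in the discrete space U is
  -- the measurability of its fibres.
  record RandomizedSolution : Set₁ where
    field
      distribution : Probability Order
      measurable   : ∀ i u → Probability.Event distribution
                               (λ σ → ⌊ Inverse.to σ i ≟ u ⌋)

  Competitive : ℝ → RandomizedSolution → Set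
  Competitive α S = ∀ k (k≤n : k ≤ˢ size) → ∃ λ v →
    IsExpectation (RandomizedSolution.distribution S) (λ σ → f (firstElements σ k)) v
    × Opt k k≤n ≤ᴿ α *ᴿ v

{-# OPTIONS --safe #-}

-- The order for a target size g runs through phases whose sizes grow by the
-- factor 5 and equal g in one of them.  In phase i it adds an optimal set of
-- size cᵢ, in an order in which, by accountability, every prefix has at least
-- its proportional share of the value.  If phase i begins after s elements,
-- then the first k elements have at least the fraction
-- min(k ∸ s, cᵢ) / max(cᵢ, k) of Opt(k), since Opt(k) is non-decreasing and
-- Opt(k) / k is non-increasing.  For g distributed log-uniformly and k → ∞ the
-- expectation of the largest of these fractions is at least 1 / 1.7643.  The
-- difference from 1 / 1.772 leaves room for taking nine values of g, for
-- rounding, and for one additional element per phase, which makes the order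
-- exhaust U.  Scaling by 5 reduces the claim for k ≥ 500 to one computation for
-- each leading part y of k in base 5 with 500 ≤ y < 2500.
module Submission where

open import Defs
open import Data.Bool using (Bool; true; false; T; not; _∧_; if_then_else_)
import Data.Bool.Properties as Bool
open import Data.Fin as Fin using (Fin)
import Data.Fin.Properties as Fin
open import Data.Integer as ℤ using (+_)
import Data.Integer.Properties as ℤ
open import Data.List as List using (List; []; _∷_; length; map)
open import Data.List.Relation.Unary.All as All using (All; []; _∷_)
open import Data.Nat as ℕ
  using (ℕ; zero; suc; _≤_; _<_; _≤ᵇ_; _+_; _*_; _^_; _∸_; _⊓_; _⊔_; _⊓′_; _⊔′_; z≤n; s≤s)
import Data.Nat.DivMod as ℕ
open import Data.Nat.Induction using (<-rec)
import Data.Nat.Properties as ℕ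
open import Data.Nat.Tactic.RingSolver using (solve-∀)
open import Data.Product using (∃; ∃₂; _×_; _,_; proj₁; proj₂)
open import Data.Rational as ℚ using (ℚ; 0ℚ; 1ℚ; _/_; toℚᵘ)
open import Data.Rational.Literals using (fromℤ)
import Data.Rational.Properties as ℚ
open import Data.Rational.Solver using (module +-*-Solver)
open import Data.Rational.Unnormalised as ℚᵘ using (mkℚᵘ; *≡*; *≤*)
import Data.Rational.Unnormalised.Properties as ℚᵘ
open import Data.Sum using (_⊎_; inj₁; inj₂; [_,_]′)
open import Data.Unit using (⊤; tt)
open import Function using (_↔_; Inverse; Equivalence; const; mk↔ₛ′)
open import Function.Construct.Symmetry using (↔-sym)
open import Function.Definitions using (Injective)
open import Relation.Binary.Definitions using (DecidableEquality; tri<; tri≈; tri>)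
open import Relation.Binary.PropositionalEquality
  using (_≡_; _≢_; refl; sym; trans; cong; cong₂; subst)
open import Relation.Nullary using (¬_; Dec; yes; no; contradiction; ⌊_⌋)
open import Relation.Nullary.Decidable using (toWitness; fromWitness)

open ℝ

-- Real numbers

fromℕ : ℕ → ℚ
fromℕ n = fromℤ (+ n)

fromℕ-+ : ∀ m n → fromℕ (m ℕ.+ n) ≡ fromℕ m ℚ.+ fromℕ n
fromℕ-+ m n = ℚ.toℚᵘ-injective (ℚᵘ.≃-trans
  (*≡* (cong (ℤ._* + 1) (cong₂ ℤ._+_ (sym (ℤ.*-identityʳ (+ m))) (sym (ℤ.*-identityʳ (+ n))))))
  (ℚᵘ.≃-sym (ℚ.toℚᵘ-homo-+ (fromℕ m) (fromℕ n))))

fromℕ-* : ∀ m n → fromℕ (m ℕ.* n) ≡ fromℕ m ℚ.* fromℕ n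
fromℕ-* m n = ℚ.toℚᵘ-injective (ℚᵘ.≃-trans
  (*≡* (cong (ℤ._* + 1) (ℤ.pos-* m n)))
  (ℚᵘ.≃-sym (ℚ.toℚᵘ-homo-* (fromℕ m) (fromℕ n))))

fromℕ-mono-≤ : ∀ {m n} → m ℕ.≤ n → fromℕ m ℚ.≤ fromℕ n
fromℕ-mono-≤ m≤n = ℚ.toℚᵘ-cancel-≤ (*≤* (ℤ.*-monoʳ-≤-nonNeg (+ 1) (ℤ.+≤+ m≤n)))

0≤fromℕ : ∀ n → 0ℚ ℚ.≤ fromℕ n
0≤fromℕ n = fromℕ-mono-≤ ℕ.z≤n

/-as-* : ∀ m n → + m / suc n ≡ (+ 1 / suc n) ℚ.* fromℕ m
/-as-* m n = ℚ.toℚᵘ-injective (begin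
  toℚᵘ (+ m / suc n)                       ≈⟨ ℚ.toℚᵘ-fromℚᵘ (mkℚᵘ (+ m) n) ⟩
  mkℚᵘ (+ m) n                             ≈⟨ *≡* (cong₂ ℤ._*_ (sym (ℤ.*-identityˡ (+ m)))
                                                       (cong +_ (ℕ.*-identityʳ (suc n)))) ⟩
  mkℚᵘ (+ 1) n ℚᵘ.* toℚᵘ (fromℕ m)         ≈⟨ ℚᵘ.*-congʳ {toℚᵘ (fromℕ m)} (ℚᵘ.≃-sym (ℚ.toℚᵘ-fromℚᵘ (mkℚᵘ (+ 1) n))) ⟩
  toℚᵘ (+ 1 / suc n) ℚᵘ.* toℚᵘ (fromℕ m)   ≈⟨ ℚᵘ.≃-sym (ℚ.toℚᵘ-homo-* (+ 1 / suc n) (fromℕ m)) ⟩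
  toℚᵘ ((+ 1 / suc n) ℚ.* fromℕ m)         ∎)
  where open import Relation.Binary.Reasoning.Setoid ℚᵘ.≃-setoid

n/n≡1 : ∀ n → + suc n / suc n ≡ 1ℚ
n/n≡1 n = ℚ.toℚᵘ-injective (ℚᵘ.≃-trans (ℚ.toℚᵘ-fromℚᵘ (mkℚᵘ (+ suc n) n))
  (*≡* (ℤ.*-comm (+ suc n) (+ 1))))

1/n*n≡1 : ∀ n → (+ 1 / suc n) ℚ.* fromℕ (suc n) ≡ 1ℚ
1/n*n≡1 n = trans (sym (/-as-* (suc n) n)) (n/n≡1 n)

0≤1/n : ∀ n → 0ℚ ℚ.≤ + 1 / suc n
0≤1/n n = ℚ.toℚᵘ-cancel-≤ (ℚᵘ.≤-respʳ-≃ (ℚᵘ.≃-sym (ℚ.toℚᵘ-fromℚᵘ (mkℚᵘ (+ 1) n)))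
  (*≤* (ℤ.+≤+ ℕ.z≤n)))

infix 4 _≼_ _≋_

-- `_≤ᴿ_` unfolds to a function type from which unification cannot recover the two reals. As
-- parameters of a record they can be inferred, which also lets `_≼_` serve in equational reasoning.
record _≼_ (x y : ℝ) : Set where
  constructor ⟪_⟫
  field ≼⇒≤ᴿ : x ≤ᴿ y
open _≼_ public

record _≋_ (x y : ℝ) : Set where
  constructor _,_
  field
    ≋⇒≼ : x ≼ y
    ≋⇒≽ : y ≼ x
open _≋_ public

abstract
  pointwise⇒≼ : ∀ {x y} → (∀ n → seq x n ≡ seq y n) → x ≼ y
  pointwise⇒≼ {x} {y} x≡y = ⟪ (λ ε 0<ε → 0 , λ n _ → begin
    seq x n          ≡⟨ x≡y n ⟩
    seq y n          ≡⟨ sym (ℚ.+-identityʳ (seq y n)) ⟩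
    seq y n ℚ.+ 0ℚ   ≤⟨ ℚ.+-monoʳ-≤ (seq y n) (ℚ.<⇒≤ 0<ε) ⟩
    seq y n ℚ.+ ε    ∎) ⟫
    where open ℚ.≤-Reasoning

  half : ∀ {ε} → 0ℚ ℚ.< ε → 0ℚ ℚ.< ℚ.½ ℚ.* ε
  half = ℚ.*-monoʳ-<-pos ℚ.½

  halves : ∀ ε → ℚ.½ ℚ.* ε ℚ.+ ℚ.½ ℚ.* ε ≡ ε
  halves ε = trans (sym (ℚ.*-distribʳ-+ ε ℚ.½ ℚ.½)) (ℚ.*-identityˡ ε)

  ≼-trans : ∀ {x y z} → x ≼ y → y ≼ z → x ≼ z
  ≼-trans {x} {y} {z} ⟪ x≤y ⟫ ⟪ y≤z ⟫ = ⟪ (λ ε 0<ε →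
    let (M , p) = x≤y (ℚ.½ ℚ.* ε) (half 0<ε)
        (N , q) = y≤z (ℚ.½ ℚ.* ε) (half 0<ε)
    in M ℕ.⊔ N , λ n M⊔N≤n → begin
      seq x n                                  ≤⟨ p n (ℕ.m⊔n≤o⇒m≤o M N M⊔N≤n) ⟩
      seq y n ℚ.+ ℚ.½ ℚ.* ε                    ≤⟨ ℚ.+-monoˡ-≤ (ℚ.½ ℚ.* ε) (q n (ℕ.m⊔n≤o⇒n≤o M N M⊔N≤n)) ⟩
      seq z n ℚ.+ ℚ.½ ℚ.* ε ℚ.+ ℚ.½ ℚ.* ε      ≡⟨ ℚ.+-assoc (seq z n) _ _ ⟩
      seq z n ℚ.+ (ℚ.½ ℚ.* ε ℚ.+ ℚ.½ ℚ.* ε)    ≡⟨ cong (seq z n ℚ.+_) (halves ε) ⟩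
      seq z n ℚ.+ ε                            ∎) ⟫
    where open ℚ.≤-Reasoning

  +-mono-≼ : ∀ {x y u v} → x ≼ y → u ≼ v → x +ᴿ u ≼ y +ᴿ v
  +-mono-≼ {x} {y} {u} {v} ⟪ x≤y ⟫ ⟪ u≤v ⟫ = ⟪ (λ ε 0<ε →
    let (M , p) = x≤y (ℚ.½ ℚ.* ε) (half 0<ε)
        (N , q) = u≤v (ℚ.½ ℚ.* ε) (half 0<ε)
    in M ℕ.⊔ N , λ n M⊔N≤n → begin
      seq x n ℚ.+ seq u n
        ≤⟨ ℚ.+-mono-≤ (p n (ℕ.m⊔n≤o⇒m≤o M N M⊔N≤n)) (q n (ℕ.m⊔n≤o⇒n≤o M N M⊔N≤n)) ⟩
      (seq y n ℚ.+ ℚ.½ ℚ.* ε) ℚ.+ (seq v n ℚ.+ ℚ.½ ℚ.* ε)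
        ≡⟨ solve 3 (λ a b c → (a :+ c) :+ (b :+ c) := (a :+ b) :+ (c :+ c)) refl (seq y n) (seq v n) (ℚ.½ ℚ.* ε) ⟩
      (seq y n ℚ.+ seq v n) ℚ.+ (ℚ.½ ℚ.* ε ℚ.+ ℚ.½ ℚ.* ε)
        ≡⟨ cong (seq y n ℚ.+ seq v n ℚ.+_) (halves ε) ⟩
      (seq y n ℚ.+ seq v n) ℚ.+ ε ∎) ⟫
    where
    open ℚ.≤-Reasoning
    open +-*-Solver

  *-monoʳ-≼ : ∀ {q x y} → 0ℚ ℚ.≤ q → x ≼ y → fromℚ q *ᴿ x ≼ fromℚ q *ᴿ y
  *-monoʳ-≼ {q} {x} {y} 0≤q ⟪ x≤y ⟫ = ⟪ (λ ε 0<ε →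
    -- The tolerance is ε / (q + 1) instead of ε / q because q may be 0.
    let δ = q+1⁻¹ ℚ.* ε
        0<δ : 0ℚ ℚ.< δ
        0<δ = subst (ℚ._< δ) (ℚ.*-zeroʳ q+1⁻¹) (ℚ.*-monoʳ-<-pos q+1⁻¹ {{ℚ.1/pos⇒pos q+1}} 0<ε)
        (N , p) = x≤y δ 0<δ
    in N , λ n N≤n → begin
      q ℚ.* seq x n                  ≤⟨ ℚ.*-monoˡ-≤-nonNeg q (p n N≤n) ⟩
      q ℚ.* (seq y n ℚ.+ δ)          ≡⟨ ℚ.*-distribˡ-+ q (seq y n) δ ⟩
      q ℚ.* seq y n ℚ.+ q ℚ.* δ      ≤⟨ ℚ.+-monoʳ-≤ (q ℚ.* seq y n) (begin
        q ℚ.* δ                 ≤⟨ ℚ.*-monoʳ-≤-nonNeg δ {{ℚ.nonNegative (ℚ.<⇒≤ 0<δ)}} q≤q+1 ⟩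
        q+1 ℚ.* (q+1⁻¹ ℚ.* ε)   ≡⟨ sym (ℚ.*-assoc q+1 q+1⁻¹ ε) ⟩
        q+1 ℚ.* q+1⁻¹ ℚ.* ε     ≡⟨ cong (ℚ._* ε) (ℚ.*-inverseʳ q+1) ⟩
        1ℚ ℚ.* ε                ≡⟨ ℚ.*-identityˡ ε ⟩
        ε                       ∎) ⟩
      q ℚ.* seq y n ℚ.+ ε            ∎) ⟫
    where
    open ℚ.≤-Reasoning
    q+1 q+1⁻¹ : ℚ
    q+1 = q ℚ.+ 1ℚ
    q≤q+1 : q ℚ.≤ q+1
    q≤q+1 = subst (ℚ._≤ q+1) (ℚ.+-identityʳ q) (ℚ.+-monoʳ-≤ q (ℚ.<⇒≤ (ℚ.positive⁻¹ 1ℚ)))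
    instance
      q-nonNeg : ℚ.NonNegative q
      q-nonNeg = ℚ.nonNegative 0≤q
      q+1-pos : ℚ.Positive q+1
      q+1-pos = ℚ.positive (ℚ.+-mono-≤-< 0≤q (ℚ.positive⁻¹ 1ℚ))
      q+1-nonZero : ℚ.NonZero q+1
      q+1-nonZero = ℚ.pos⇒nonZero q+1
    q+1⁻¹ = ℚ.1/ q+1

  -- Write q x as p x + (q - p) x; the second summand is at least (q - p) 0.
  *-monoˡ-≼ : ∀ {p q x} → 0ᴿ ≼ x → p ℚ.≤ q → fromℚ p *ᴿ x ≼ fromℚ q *ᴿ x
  *-monoˡ-≼ {p} {q} {x} 0≼x p≤q =
    ≼-trans {y = px +ᴿ fromℚ (q ℚ.- p) *ᴿ 0ᴿ} (pointwise⇒≼ {px} λ n →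
      solve 3 (λ p q x → p :* x := p :* x :+ (q :- p) :* con 0ℚ) refl p q (seq x n))
    (≼-trans {y = px +ᴿ fromℚ (q ℚ.- p) *ᴿ x}
      (+-mono-≼ {px} (pointwise⇒≼ {px} (λ _ → refl))
        (*-monoʳ-≼ {q ℚ.- p} {0ᴿ} {x}
          (subst (ℚ._≤ q ℚ.- p) (ℚ.+-inverseʳ p) (ℚ.+-monoˡ-≤ (ℚ.- p) p≤q)) 0≼x))
      (pointwise⇒≼ {y = fromℚ q *ᴿ x} λ n →
        solve 3 (λ p q x → p :* x :+ (q :- p) :* x := q :* x) refl p q (seq x n)))
    where
    open +-*-Solver
    px : ℝ
    px = fromℚ p *ᴿ x

≼-refl : ∀ {x} → x ≼ x
≼-refl {x} = pointwise⇒≼ {x} {x} (λ _ → refl)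

module ≼-Reasoning where
  open import Relation.Binary.Reasoning.Base.Single _≼_ ≼-refl ≼-trans public hiding (start)

≋-refl : ∀ {x} → x ≋ x
≋-refl = ≼-refl , ≼-refl

≋-sym : ∀ {x y} → x ≋ y → y ≋ x
≋-sym (p , q) = q , p

≋-trans : ∀ {x y z} → x ≋ y → y ≋ z → x ≋ z
≋-trans (p , q) (r , s) = ≼-trans p r , ≼-trans s q

pointwise⇒≋ : ∀ {x y} → (∀ n → seq x n ≡ seq y n) → x ≋ y
pointwise⇒≋ {x} {y} x≡y = pointwise⇒≼ {x} {y} x≡y , pointwise⇒≼ {y} {x} (λ n → sym (x≡y n))

+-cong-≋ : ∀ {x y u v} → x ≋ y → u ≋ v → x +ᴿ u ≋ y +ᴿ v
+-cong-≋ {x} {y} {u} {v} (p , q) (r , s) =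
  +-mono-≼ {x} {y} {u} {v} p r , +-mono-≼ {y} {x} {v} {u} q s

-- Multiples by natural numbers

infixr 7 _·_

abstract
  -- Bounds on ratios are stated cross-multiplied, as `a · x ≼ b · y`, so that they combine by
  -- arithmetic in ℕ and only positive factors have to be cancelled.
  _·_ : ℕ → ℝ → ℝ
  n · x = fromℚ (fromℕ n) *ᴿ x

  ·-monoʳ : ∀ n {x y} → x ≼ y → n · x ≼ n · y
  ·-monoʳ n {x} {y} = *-monoʳ-≼ {fromℕ n} {x} {y} (0≤fromℕ n)

  ·-monoˡ : ∀ {m n x} → 0ᴿ ≼ x → m ℕ.≤ n → m · x ≼ n · x
  ·-monoˡ {m} {n} {x} 0≼x m≤n = *-monoˡ-≼ {fromℕ m} {fromℕ n} {x} 0≼x (fromℕ-mono-≤ m≤n)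

  ·-assoc : ∀ m n x → (m ℕ.* n) · x ≋ m · n · x
  ·-assoc m n x = pointwise⇒≋ {(m ℕ.* n) · x} {m · n · x} λ i →
    trans (cong (ℚ._* seq x i) (fromℕ-* m n)) (ℚ.*-assoc (fromℕ m) (fromℕ n) (seq x i))

  ·-swap : ∀ m n x → m · n · x ≋ n · m · x
  ·-swap m n x = pointwise⇒≋ {m · n · x} {n · m · x} λ i →
    solve 3 (λ m n x → m :* (n :* x) := n :* (m :* x)) refl (fromℕ m) (fromℕ n) (seq x i)
    where open +-*-Solver

  ·-distribʳ : ∀ m n x → (m ℕ.+ n) · x ≋ m · x +ᴿ n · x
  ·-distribʳ m n x = pointwise⇒≋ {(m ℕ.+ n) · x} {m · x +ᴿ n · x} λ i →
    trans (cong (ℚ._* seq x i) (fromℕ-+ m n)) (ℚ.*-distribʳ-+ (seq x i) (fromℕ m) (fromℕ n))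

  ·-distribˡ : ∀ n x y → n · (x +ᴿ y) ≋ n · x +ᴿ n · y
  ·-distribˡ n x y = pointwise⇒≋ {n · (x +ᴿ y)} {n · x +ᴿ n · y} λ i →
    ℚ.*-distribˡ-+ (fromℕ n) (seq x i) (seq y i)

  1/n·n : ∀ n x → fromℚ (+ 1 / suc n) *ᴿ (suc n · x) ≋ x
  1/n·n n x = pointwise⇒≋ {fromℚ (+ 1 / suc n) *ᴿ (suc n · x)} {x} λ i → trans
    (sym (ℚ.*-assoc (+ 1 / suc n) (fromℕ (suc n)) (seq x i)))
    (trans (cong (ℚ._* seq x i) (1/n*n≡1 n)) (ℚ.*-identityˡ (seq x i)))

  n·1/n : ∀ n x → suc n · (fromℚ (+ 1 / suc n) *ᴿ x) ≋ x
  n·1/n n x = pointwise⇒≋ {suc n · (fromℚ (+ 1 / suc n) *ᴿ x)} {x} λ i → trans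
    (sym (ℚ.*-assoc (fromℕ (suc n)) (+ 1 / suc n) (seq x i)))
    (trans (cong (ℚ._* seq x i) (trans (ℚ.*-comm (fromℕ (suc n)) (+ 1 / suc n)) (1/n*n≡1 n)))
           (ℚ.*-identityˡ (seq x i)))

  m/n·n : ∀ m n x → suc n · (fromℚ (+ m / suc n) *ᴿ x) ≋ m · x
  m/n·n m n x = pointwise⇒≋ {suc n · (fromℚ (+ m / suc n) *ᴿ x)} {m · x} λ i →
    trans (sym (ℚ.*-assoc (fromℕ (suc n)) (+ m / suc n) (seq x i)))
      (cong (ℚ._* seq x i) (trans (cong (fromℕ (suc n) ℚ.*_) (/-as-* m n))
        (trans (sym (ℚ.*-assoc (fromℕ (suc n)) (+ 1 / suc n) (fromℕ m)))
          (trans (cong (ℚ._* fromℕ m) (trans (ℚ.*-comm (fromℕ (suc n)) (+ 1 / suc n)) (1/n*n≡1 n)))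
            (ℚ.*-identityˡ (fromℕ m))))))

  -- Clears the denominator in the accountability bound for a set of n + 1 elements: (n + 1) (1 - 1
  -- / (n + 1)) = n.
  1-1/n : ∀ n {x y} → x -ᴿ fromℚ (+ 1 / suc n) *ᴿ x ≼ y → n · x ≼ suc n · y
  1-1/n n {x} {y} p = ≼-trans {y = suc n · (x -ᴿ fromℚ (+ 1 / suc n) *ᴿ x)}
    (pointwise⇒≼ {n · x} {suc n · (x -ᴿ fromℚ (+ 1 / suc n) *ᴿ x)} λ i → eq (seq x i))
    (·-monoʳ (suc n) p)
    where
    open ℚ.≤-Reasoning
    eq : ∀ a → fromℕ n ℚ.* a ≡ fromℕ (suc n) ℚ.* (a ℚ.- (+ 1 / suc n) ℚ.* a)
    eq a = sym (begin-equality
      fromℕ (suc n) ℚ.* (a ℚ.- (+ 1 / suc n) ℚ.* a)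
        ≡⟨ solve 3 (λ s r a → s :* (a :- r :* a) := s :* a :- r :* s :* a) refl (fromℕ (suc n)) (+ 1 / suc n) a ⟩
      fromℕ (suc n) ℚ.* a ℚ.- (+ 1 / suc n) ℚ.* fromℕ (suc n) ℚ.* a
        ≡⟨ cong₂ (λ s t → s ℚ.* a ℚ.- t ℚ.* a) (fromℕ-+ 1 n) (1/n*n≡1 n) ⟩
      (1ℚ ℚ.+ fromℕ n) ℚ.* a ℚ.- 1ℚ ℚ.* a
        ≡⟨ solve 2 (λ m a → (con 1ℚ :+ m) :* a :- con 1ℚ :* a := m :* a) refl (fromℕ n) a ⟩
      fromℕ n ℚ.* a ∎)
      where open +-*-Solver

  0≼· : ∀ n {x} → 0ᴿ ≼ x → 0ᴿ ≼ n · x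
  0≼· n {x} 0≼x = ≼-trans {y = n · 0ᴿ}
    (pointwise⇒≼ {0ᴿ} {n · 0ᴿ} (λ i → sym (ℚ.*-zeroʳ (fromℕ n)))) (·-monoʳ n 0≼x)

  0·≋0 : ∀ x → 0 · x ≋ 0ᴿ
  0·≋0 x = pointwise⇒≋ {0 · x} {0ᴿ} λ i → ℚ.*-zeroˡ (seq x i)

  ·0≋0 : ∀ n → n · 0ᴿ ≋ 0ᴿ
  ·0≋0 n = pointwise⇒≋ {n · 0ᴿ} {0ᴿ} λ i → ℚ.*-zeroʳ (fromℕ n)

  1·≋ : ∀ x → 1 · x ≋ x
  1·≋ x = pointwise⇒≋ {1 · x} {x} λ i → ℚ.*-identityˡ (seq x i)

·-cancel : ∀ n {x y} → suc n · x ≼ suc n · y → x ≼ y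
·-cancel n {x} {y} p = ≼-trans (≋⇒≽ (1/n·n n x)) (≼-trans
  (*-monoʳ-≼ {+ 1 / suc n} {suc n · x} {suc n · y} (0≤1/n n) p) (≋⇒≼ (1/n·n n y)))

-- Finite probability spaces

abstract
  +-identityˡ-≋ : ∀ x → 0ᴿ +ᴿ x ≋ x
  +-identityˡ-≋ x = pointwise⇒≋ {0ᴿ +ᴿ x} {x} λ i → ℚ.+-identityˡ (seq x i)

  +-identityʳ-≋ : ∀ x → x +ᴿ 0ᴿ ≋ x
  +-identityʳ-≋ x = pointwise⇒≋ {x +ᴿ 0ᴿ} {x} λ i → ℚ.+-identityʳ (seq x i)

  +-interchange-≋ : ∀ x y u v → (x +ᴿ y) +ᴿ (u +ᴿ v) ≋ (x +ᴿ u) +ᴿ (y +ᴿ v)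
  +-interchange-≋ x y u v = pointwise⇒≋ {(x +ᴿ y) +ᴿ (u +ᴿ v)} {(x +ᴿ u) +ᴿ (y +ᴿ v)} λ i →
    solve 4 (λ x y u v → (x :+ y) :+ (u :+ v) := (x :+ u) :+ (y :+ v)) refl
      (seq x i) (seq y i) (seq u i) (seq v i)
    where
    open +-*-Solver

  *-comm-≋ : ∀ x y → x *ᴿ y ≋ y *ᴿ x
  *-comm-≋ x y = pointwise⇒≋ {x *ᴿ y} {y *ᴿ x} λ i → ℚ.*-comm (seq x i) (seq y i)

  *-distribˡ-≋ : ∀ x y z → x *ᴿ (y +ᴿ z) ≋ x *ᴿ y +ᴿ x *ᴿ z
  *-distribˡ-≋ x y z = pointwise⇒≋ {x *ᴿ (y +ᴿ z)} {x *ᴿ y +ᴿ x *ᴿ z} λ i →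
    ℚ.*-distribˡ-+ (seq x i) (seq y i) (seq z i)

  *-zeroʳ-≋ : ∀ x → x *ᴿ 0ᴿ ≋ 0ᴿ
  *-zeroʳ-≋ x = pointwise⇒≋ {x *ᴿ 0ᴿ} {0ᴿ} λ i → ℚ.*-zeroʳ (seq x i)

  *-fromℚ-cong-≋ : ∀ {x y} q → 0ℚ ℚ.≤ q → x ≋ y → x *ᴿ fromℚ q ≋ y *ᴿ fromℚ q
  *-fromℚ-cong-≋ {x} {y} q 0≤q (x≼y , y≼x) =
    ≋-trans (*-comm-≋ x (fromℚ q)) (≋-trans
      (*-monoʳ-≼ {q} {x} {y} 0≤q x≼y , *-monoʳ-≼ {q} {y} {x} 0≤q y≼x)
      (*-comm-≋ (fromℚ q) y))

  ≼-+-ε : ∀ {x y ε} → 0ℚ ℚ.< ε → x ≼ y → x ≼ y +ᴿ fromℚ ε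
  ≼-+-ε {x} {y} {ε} 0<ε x≼y = ≼-trans (≋⇒≽ (+-identityʳ-≋ x))
    (+-mono-≼ {x} {y} {0ᴿ} {fromℚ ε} x≼y ⟪ (λ δ 0<δ → 0 , λ _ _ →
      ℚ.<⇒≤ (subst (ℚ._< ε ℚ.+ δ) (ℚ.+-identityˡ 0ℚ) (ℚ.+-mono-< 0<ε 0<δ))) ⟫)

-- All series over a finite space have finitely many non-zero terms. Their partial sums become
-- constant, and this form can be added over the atoms without any ε.
EventuallySum : (ℕ → ℝ) → ℝ → Set
EventuallySum t s = ∃ λ M → ∀ n → M ≤ n → partialSum t n ≋ s

eventually⇒HasSum : ∀ {t s} → EventuallySum t s → HasSum t s
eventually⇒HasSum (M , eq) ε 0<ε = M , λ n M≤n →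
  ≼⇒≤ᴿ (≼-+-ε 0<ε (≋⇒≼ (eq n M≤n))) , ≼⇒≤ᴿ (≼-+-ε 0<ε (≋⇒≽ (eq n M≤n)))

partialSum-cong : ∀ {t t′} → (∀ n → t n ≋ t′ n) → ∀ n → partialSum t n ≋ partialSum t′ n
partialSum-cong eq zero    = ≋-refl
partialSum-cong {t} {t′} eq (suc n) =
  +-cong-≋ {partialSum t n} {partialSum t′ n} {t n} {t′ n} (partialSum-cong eq n) (eq n)

partialSum-+ : ∀ t u n → partialSum (λ i → t i +ᴿ u i) n ≋ partialSum t n +ᴿ partialSum u n
partialSum-+ t u zero    = ≋-sym (+-identityˡ-≋ 0ᴿ)
partialSum-+ t u (suc n) = ≋-trans
  (+-cong-≋ {partialSum (λ i → t i +ᴿ u i) n} {partialSum t n +ᴿ partialSum u n}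
    {t n +ᴿ u n} {t n +ᴿ u n} (partialSum-+ t u n) ≋-refl)
  (+-interchange-≋ (partialSum t n) (partialSum u n) (t n) (u n))

partialSum-0 : ∀ {t} n → (∀ i → i < n → t i ≋ 0ᴿ) → partialSum t n ≋ 0ᴿ
partialSum-0 zero    zeros = ≋-refl
partialSum-0 {t} (suc n) zeros = ≋-trans
  (+-cong-≋ {partialSum t n} {0ᴿ} {t n} {0ᴿ}
    (partialSum-0 n (λ i i<n → zeros i (ℕ.m<n⇒m<1+n i<n))) (zeros n ℕ.≤-refl))
  (+-identityˡ-≋ 0ᴿ)

partialSum-single : ∀ {t} m n → (∀ i → i ≢ m → t i ≋ 0ᴿ) → m < n → partialSum t n ≋ t m
partialSum-single {t} m (suc n) zeros (s≤s m≤n) with ℕ.m≤n⇒m<n∨m≡n m≤n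
... | inj₁ m<n  = ≋-trans
  (+-cong-≋ {partialSum t n} {t m} {t n} {0ᴿ}
    (partialSum-single m n zeros m<n) (zeros n (λ n≡m → ℕ.<⇒≢ m<n (sym n≡m))))
  (+-identityʳ-≋ (t m))
... | inj₂ refl = ≋-trans
  (+-cong-≋ {partialSum t m} {0ᴿ} {t m} {t m}
    (partialSum-0 m (λ i i<m → zeros i (ℕ.<⇒≢ i<m))) ≋-refl)
  (+-identityˡ-≋ (t m))

eventually-cong : ∀ {t t′ s s′} → (∀ n → t n ≋ t′ n) → s ≋ s′ →
                  EventuallySum t s → EventuallySum t′ s′
eventually-cong t≋t′ s≋s′ (M , eq) = M , λ n M≤n →
  ≋-trans (≋-sym (partialSum-cong t≋t′ n)) (≋-trans (eq n M≤n) s≋s′)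

eventually-0 : ∀ {t} → (∀ i → t i ≋ 0ᴿ) → EventuallySum t 0ᴿ
eventually-0 zeros = 0 , λ n _ → partialSum-0 n (λ i _ → zeros i)

eventually-single : ∀ {t} m → (∀ i → i ≢ m → t i ≋ 0ᴿ) → EventuallySum t (t m)
eventually-single m zeros = suc m , λ n m<n → partialSum-single m n zeros m<n

∑ : ∀ {A : Set} → List A → (A → ℝ) → ℝ
∑ []       h = 0ᴿ
∑ (a ∷ as) h = h a +ᴿ ∑ as h

∑-mono : ∀ {A : Set} {g h : A → ℝ} as → (∀ a → g a ≼ h a) → ∑ as g ≼ ∑ as h
∑-mono []       g≼h = ≼-refl
∑-mono {g = g} {h} (a ∷ as) g≼h =
  +-mono-≼ {g a} {h a} {∑ as g} {∑ as h} (g≼h a) (∑-mono as g≼h)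

∑-cong : ∀ {A : Set} {g h : A → ℝ} as → (∀ a → g a ≋ h a) → ∑ as g ≋ ∑ as h
∑-cong as g≋h = ∑-mono as (λ a → ≋⇒≼ (g≋h a)) , ∑-mono as (λ a → ≋⇒≽ (g≋h a))

*-distribˡ-∑ : ∀ {A : Set} x as (h : A → ℝ) → x *ᴿ ∑ as h ≋ ∑ as (λ a → x *ᴿ h a)
*-distribˡ-∑ x []       h = *-zeroʳ-≋ x
*-distribˡ-∑ x (a ∷ as) h = ≋-trans (*-distribˡ-≋ x (h a) (∑ as h))
  (+-cong-≋ {x *ᴿ h a} {x *ᴿ h a} {x *ᴿ ∑ as h} {∑ as (λ a → x *ᴿ h a)}
    ≋-refl (*-distribˡ-∑ x as h))

eventually-∑ : ∀ {A : Set} {t : A → ℕ → ℝ} {s : A → ℝ} as →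
  All (λ a → EventuallySum (t a) (s a)) as →
  EventuallySum (λ n → ∑ as (λ a → t a n)) (∑ as s)
eventually-∑ [] [] = eventually-0 (λ _ → ≋-refl)
eventually-∑ {t = t} {s} (a ∷ as) ((M , p) ∷ ps) with eventually-∑ {t = t} {s} as ps
... | N , q = M ⊔ N , λ n M⊔N≤n → ≋-trans
  (partialSum-+ (t a) (λ i → ∑ as (λ a → t a i)) n)
  (+-cong-≋ {partialSum (t a) n} {s a} {partialSum (λ i → ∑ as (λ a → t a i)) n} {∑ as s}
    (p n (ℕ.m⊔n≤o⇒m≤o M N M⊔N≤n)) (q n (ℕ.m⊔n≤o⇒n≤o M N M⊔N≤n)))

∑-const : ∀ {A : Set} (as : List A) x → ∑ as (const x) ≋ length as · x
∑-const []       x = ≋-sym (0·≋0 x)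
∑-const (a ∷ as) x = ≋-sym (≋-trans (·-distribʳ 1 (length as) x)
  (+-cong-≋ {1 · x} {x} {length as · x} {∑ as (const x)} (1·≋ x) (≋-sym (∑-const as x))))

-- A repeated atom carries its weight once per occurrence, so the orders for different targets may
-- coincide. The list is split into head and tail to make it non-empty.
module Uniform {Ω : Set} (a₀ : Ω) (as : List Ω) where

  atoms : List Ω
  atoms = a₀ ∷ as

  weight : ℚ
  weight = + 1 / suc (length as)

  mass : Bool → ℝ
  mass b = if b then fromℚ weight else 0ᴿ

  probability : 𝒫 Ω → ℝ
  probability A = ∑ atoms (λ a → mass (A a))

  0≼weight : 0ᴿ ≼ fromℚ weight
  0≼weight = ≼-trans (≋⇒≽ (*-zeroʳ-≋ (fromℚ weight)))
    (≼-trans (*-monoʳ-≼ {weight} {0ᴿ} {1ᴿ} (0≤1/n (length as)) 0≼1)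
      (pointwise⇒≼ {fromℚ weight *ᴿ 1ᴿ} {fromℚ weight} (λ _ → ℚ.*-identityʳ weight)))
    where
    0≼1 : 0ᴿ ≼ 1ᴿ
    0≼1 = ⟪ (λ ε 0<ε → 0 , λ _ _ → ℚ.<⇒≤ (ℚ.+-mono-< (ℚ.positive⁻¹ 1ℚ) 0<ε)) ⟫

  0≼mass : ∀ b → 0ᴿ ≼ mass b
  0≼mass true  = 0≼weight
  0≼mass false = ≼-refl

  ∑-zero : ∀ (bs : List Ω) → ∑ bs (const 0ᴿ) ≋ 0ᴿ
  ∑-zero bs = ≋-trans (∑-const bs 0ᴿ) (·0≋0 (length bs))

  length·weight : suc (length as) · fromℚ weight ≋ 1ᴿ
  length·weight = ≋-trans
    (·-monoʳ N (pointwise⇒≼ {fromℚ weight} {fromℚ weight *ᴿ 1ᴿ} λ _ → sym (ℚ.*-identityʳ weight)) ,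
     ·-monoʳ N (pointwise⇒≼ {fromℚ weight *ᴿ 1ᴿ} {fromℚ weight} λ _ → ℚ.*-identityʳ weight))
    (n·1/n (length as) 1ᴿ)
    where N = suc (length as)

  mass-true : ∀ {b} → T b → mass b ≋ fromℚ weight
  mass-true {true} _ = ≋-refl

  mass-false : ∀ {b} → ¬ T b → mass b ≋ 0ᴿ
  mass-false {true}  ¬b = contradiction tt ¬b
  mass-false {false} _  = ≋-refl

  -- An atom in the union lies in exactly one of the disjoint sets, so its series has a single
  -- non-zero term; for any other atom all terms vanish.
  atom-additive : ∀ {A : ℕ → 𝒫 Ω} {B} → Disjoint A → IsUnion A B → ∀ a →
    EventuallySum (λ n → mass (A n a)) (mass (B a))
  atom-additive {A} {B} disjoint union a with B a in eq
  ... | true  =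
    let (m , a∈Aₘ) = Equivalence.to (union a) (subst T (sym eq) tt)
    in eventually-cong (λ _ → ≋-refl) (mass-true a∈Aₘ)
         (eventually-single m λ i i≢m → mass-false λ a∈Aᵢ → i≢m (disjoint i m a a∈Aᵢ a∈Aₘ))
  ... | false = eventually-0 λ i → mass-false λ a∈Aᵢ →
    subst T eq (Equivalence.from (union a) (i , a∈Aᵢ))

  uniform : Probability Ω
  uniform = record
    { Event      = const ⊤
    ; event-full = tt
    ; event-∁    = λ _ → tt
    ; event-∪    = λ _ _ → tt
    ; ℙ          = λ {A} _ → probability A
    ; ℙ-nonNeg   = λ {A} _ → ≼⇒≤ᴿ (≼-trans (≋⇒≽ (∑-zero atoms)) (∑-mono atoms (λ a → 0≼mass (A a))))
    ; ℙ-full     = let eq = ≋-trans (∑-const atoms (fromℚ weight)) length·weight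
                   in ≼⇒≤ᴿ (≋⇒≼ eq) , ≼⇒≤ᴿ (≋⇒≽ eq)
    ; ℙ-additive = λ {A} {B} _ _ disjoint union → eventually⇒HasSum
        (eventually-∑ {t = λ a n → mass (A n a)} {λ a → mass (B a)} atoms
          (All.universal (atom-additive disjoint union) atoms))
    }

  mean : (Ω → ℝ) → ℝ
  mean F = ∑ atoms (λ a → F a *ᴿ fromℚ weight)

  -- A random variable that is determined by a decidable equivalence has
  -- one piece for each atom, the class of that atom minus the earlier classes.
  module _ (_~_ : Ω → Ω → Bool) (~-refl : ∀ a → T (a ~ a))
           (F : Ω → ℝ) (F-cong : ∀ a b → T (a ~ b) → F b ≋ F a) where

    piece : List Ω → ℕ → 𝒫 Ω
    piece []       _       ω = false
    piece (b ∷ bs) zero    ω = b ~ ω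
    piece (b ∷ bs) (suc n) ω = not (b ~ ω) ∧ piece bs n ω

    value : List Ω → ℕ → ℝ
    value []       _       = 0ᴿ
    value (b ∷ bs) zero    = F b
    value (b ∷ bs) (suc n) = value bs n

    not-both : ∀ {b c} → T b → T (not b ∧ c) → ∀ {A : Set} → A
    not-both {true} _ ()

    piece-disjoint : ∀ bs → Disjoint (piece bs)
    piece-disjoint (b ∷ bs) zero    zero    ω _ _ = refl
    piece-disjoint (b ∷ bs) zero    (suc n) ω p q = not-both p q
    piece-disjoint (b ∷ bs) (suc m) zero    ω p q = not-both q p
    piece-disjoint (b ∷ bs) (suc m) (suc n) ω p q =
      cong suc (piece-disjoint bs m n ω (proj₂ (Equivalence.to (Bool.T-∧ {not (b ~ ω)}) p))
                                        (proj₂ (Equivalence.to (Bool.T-∧ {not (b ~ ω)}) q)))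

    piece-value : ∀ bs n ω → ω ∈ piece bs n → F ω ≋ value bs n
    piece-value (b ∷ bs) zero    ω p = F-cong b ω p
    piece-value (b ∷ bs) (suc n) ω p =
      piece-value bs n ω (proj₂ (Equivalence.to (Bool.T-∧ {not (b ~ ω)}) p))

    piece-covers : ∀ bs → All (λ b → ∃ λ n → b ∈ piece bs n) bs
    piece-covers []       = []
    piece-covers (b ∷ bs) = (zero , ~-refl b) ∷ All.map shift (piece-covers bs)
      where
      shift : ∀ {ω} → (∃ λ n → ω ∈ piece bs n) → ∃ λ n → ω ∈ piece (b ∷ bs) n
      shift {ω} (n , p) with b ~ ω in eq
      ... | true  = zero , subst T (sym eq) tt
      ... | false = suc n , subst (λ c → T (not c ∧ piece bs n ω)) (sym eq) p

    -- Exchange the sums over pieces and atoms: each atom lies in exactly one piece and contributes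
    -- the value there times its weight. With G = 1 this yields `covers`, with G = F it yields
    -- `sum`.
    weighted-sum : ∀ (v : ℕ → ℝ) (G : Ω → ℝ) →
      (∀ n ω → ω ∈ piece atoms n → G ω ≋ v n) →
      EventuallySum (λ n → v n *ᴿ probability (piece atoms n)) (mean G)
    weighted-sum v G G≋v = eventually-cong
      (λ n → ≋-sym (*-distribˡ-∑ (v n) atoms (λ a → mass (piece atoms n a)))) ≋-refl
      (eventually-∑ {t = λ a n → v n *ᴿ mass (piece atoms n a)} {λ a → G a *ᴿ fromℚ weight}
        atoms (All.map atom (piece-covers atoms)))
      where
      zero-term : ∀ n {a} → ¬ (a ∈ piece atoms n) → v n *ᴿ mass (piece atoms n a) ≋ 0ᴿ
      zero-term n {a} a∉ with piece atoms n a
      ... | true  = contradiction tt a∉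
      ... | false = *-zeroʳ-≋ (v n)
      full-term : ∀ n {a} → a ∈ piece atoms n →
                  v n *ᴿ mass (piece atoms n a) ≋ v n *ᴿ fromℚ weight
      full-term n {a} a∈ with piece atoms n a
      ... | true = ≋-refl
      atom : ∀ {a} → (∃ λ n → a ∈ piece atoms n) →
        EventuallySum (λ n → v n *ᴿ mass (piece atoms n a)) (G a *ᴿ fromℚ weight)
      atom {a} (m , a∈) = eventually-cong (λ _ → ≋-refl)
        (≋-trans (full-term m a∈)
          (*-fromℚ-cong-≋ weight (0≤1/n (length as)) (≋-sym (G≋v m a a∈))))
        (eventually-single m λ i i≢m → zero-term i λ a∈ᵢ → i≢m (piece-disjoint atoms i m a a∈ᵢ a∈))

    isExpectation : IsExpectation uniform F (mean F)
    isExpectation = record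
      { piece    = piece atoms
      ; event    = λ _ → tt
      ; disjoint = piece-disjoint atoms
      ; covers   = eventually⇒HasSum (eventually-cong
          (λ n → 1*≋ (probability (piece atoms n)))
          (≋-trans (∑-cong atoms (λ _ → 1*≋ (fromℚ weight)))
            (≋-trans (∑-const atoms (fromℚ weight)) length·weight))
          (weighted-sum (const 1ᴿ) (const 1ᴿ) (λ _ _ _ → ≋-refl)))
      ; value    = value atoms
      ; constant = λ n ω p → let eq = piece-value atoms n ω p
                             in ≼⇒≤ᴿ (≋⇒≼ eq) , ≼⇒≤ᴿ (≋⇒≽ eq)
      ; sum      = eventually⇒HasSum (weighted-sum (value atoms) F (piece-value atoms))
      }
      where
      1*≋ : ∀ x → 1ᴿ *ᴿ x ≋ x
      1*≋ x = pointwise⇒≋ {1ᴿ *ᴿ x} {x} λ i → ℚ.*-identityˡ (seq x i)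

-- Orders from streams

_≤ˢ?_ : ∀ k s → Dec (k ≤ˢ s)
k ≤ˢ? finite n = k ℕ.≤? n
k ≤ˢ? infinite = yes tt

≤-≤ˢ-trans : ∀ s {j k} → j ≤ k → k ≤ˢ s → j ≤ˢ s
≤-≤ˢ-trans (finite n) j≤k k≤n = ℕ.≤-trans j≤k k≤n
≤-≤ˢ-trans infinite   _   _   = tt

position : ∀ s i → suc i ≤ˢ s → Position s
position (finite n) i i<n = Fin.fromℕ< i<n
position infinite   i _   = i

index-position : ∀ s i i<s → index s (position s i i<s) ≡ i
index-position (finite n) i i<n = Fin.toℕ-fromℕ< i<n
index-position infinite   i _   = refl

index-injective : ∀ s {p q} → index s p ≡ index s q → p ≡ q
index-injective (finite n) = Fin.toℕ-injective
index-injective infinite eq = eq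

index<size : ∀ s p → suc (index s p) ≤ˢ s
index<size (finite n) p = Fin.toℕ<n p
index<size infinite   p = tt

injection⇒≤ˢ : ∀ s {m} (h : Fin m → Position s) → Injective _≡_ _≡_ h → m ≤ˢ s
injection⇒≤ˢ (finite n) h inj = Fin.injective⇒≤ inj
injection⇒≤ˢ infinite   h inj = tt

∃-≡ : ∀ {A : Set} {X : 𝒫 A} {p q : ∃ λ a → a ∈ X} → proj₁ p ≡ proj₁ q → p ≡ q
∃-≡ {p = a , a∈X} {q = .a , a∈X′} refl = cong (a ,_) (Bool.T-irrelevant a∈X a∈X′)

module _ {A B : Set} (i : A ↔ B) where

  open Inverse i

  to-injective : Injective _≡_ _≡_ to
  to-injective {x} {y} eq =
    trans (sym (strictlyInverseʳ x)) (trans (cong from eq) (strictlyInverseʳ y))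

  from-injective : Injective _≡_ _≡_ from
  from-injective {x} {y} eq =
    trans (sym (strictlyInverseˡ x)) (trans (cong to eq) (strictlyInverseˡ y))

module FirstOccurrences {U : Set} (_≟_ : DecidableEquality U) (e : ℕ → U) where

  Repeat : ℕ → Set
  Repeat m = ∃ λ j → j < m × e j ≡ e m

  repeat? : ∀ m → Dec (Repeat m)
  repeat? m = ℕ.anyUpTo? (λ j → e j ≟ e m) m

  -- The number of distinct elements among the first m entries of the stream.
  rank : ℕ → ℕ
  rank zero = zero
  rank (suc m) with repeat? m
  ... | yes _ = rank m
  ... | no  _ = suc (rank m)

  rank-suc : ∀ {m} → ¬ Repeat m → rank (suc m) ≡ suc (rank m)
  rank-suc {m} new with repeat? m
  ... | yes rep = contradiction rep new
  ... | no  _   = refl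

  rank-≤-suc : ∀ m → rank m ≤ rank (suc m)
  rank-≤-suc m with repeat? m
  ... | yes _ = ℕ.≤-refl
  ... | no  _ = ℕ.n≤1+n _

  rank-mono-≤ : ∀ {m n} → m ≤ n → rank m ≤ rank n
  rank-mono-≤ {n = zero} z≤n = z≤n
  rank-mono-≤ {m} {suc n} m≤1+n with ℕ.m≤n⇒m<n∨m≡n m≤1+n
  ... | inj₁ (s≤s m≤n) = ℕ.≤-trans (rank-mono-≤ m≤n) (rank-≤-suc n)
  ... | inj₂ refl      = ℕ.≤-refl

  rank-mono-< : ∀ {m n} → ¬ Repeat m → m < n → rank m < rank n
  rank-mono-< {n = n} new m<n = subst (_≤ rank n) (rank-suc new) (rank-mono-≤ m<n)

  rank≤ : ∀ m → rank m ≤ m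
  rank≤ zero = z≤n
  rank≤ (suc m) with repeat? m
  ... | yes _ = ℕ.m≤n⇒m≤1+n (rank≤ m)
  ... | no  _ = s≤s (rank≤ m)

  rank-injective : ∀ {m n} → ¬ Repeat m → ¬ Repeat n → rank m ≡ rank n → m ≡ n
  rank-injective {m} {n} m-new n-new eq with ℕ.<-cmp m n
  ... | tri< m<n _ _ = contradiction eq (ℕ.<⇒≢ (rank-mono-< m-new m<n))
  ... | tri≈ _ m≡n _ = m≡n
  ... | tri> _ _ n<m = contradiction (sym eq) (ℕ.<⇒≢ (rank-mono-< n-new n<m))

  -- The rank starts at 0 and rises in steps of one, each at a position that holds a new element; so
  -- it passes through every value below `rank M`.
  rank-surjective : ∀ M {i} → i < rank M → ∃ λ m → ¬ Repeat m × rank m ≡ i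
  rank-surjective (suc M) {i} i<r with repeat? M
  ... | yes _   = rank-surjective M i<r
  ... | no new with ℕ.m≤n⇒m<n∨m≡n i<r
  ...   | inj₁ (s≤s i<r′) = rank-surjective M i<r′
  ...   | inj₂ refl       = M , new , refl

  first : ∀ m → ∃ λ l → l ≤ m × e l ≡ e m × ¬ Repeat l
  first = <-rec _ step
    where
    step : ∀ m → (∀ {j} → j < m → ∃ λ l → l ≤ j × e l ≡ e j × ¬ Repeat l) →
           ∃ λ l → l ≤ m × e l ≡ e m × ¬ Repeat l
    step m rec with repeat? m
    ... | no  new = m , ℕ.≤-refl , refl , new
    ... | yes (j , j<m , ej≡em) =
      let (l , l≤j , el≡ej , new) = rec j<m
      in l , ℕ.≤-trans l≤j (ℕ.<⇒≤ j<m) , trans el≡ej ej≡em , new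

  first-unique : ∀ {m n} → ¬ Repeat m → ¬ Repeat n → e m ≡ e n → m ≡ n
  first-unique {m} {n} m-new n-new eq with ℕ.<-cmp m n
  ... | tri< m<n _ _ = contradiction (m , m<n , eq) n-new
  ... | tri≈ _ m≡n _ = m≡n
  ... | tri> _ _ n<m = contradiction (n , n<m , sym eq) m-new

-- Deleting repetitions turns a stream that exhausts U into an order of U: each element moves to the
-- rank of its first occurrence.
module StreamOrder {U : Set} (s : Size) (countable : U ↔ Position s)
  (_≟_ : DecidableEquality U) (e : ℕ → U) (occurs : ∀ u → ∃ λ m → e m ≡ u) where

  open FirstOccurrences _≟_ e

  private
    module C = Inverse countable

  occurrence : U → ℕ
  occurrence u = proj₁ (first (proj₁ (occurs u)))

  occurrence-new : ∀ u → ¬ Repeat (occurrence u)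
  occurrence-new u = proj₂ (proj₂ (proj₂ (first (proj₁ (occurs u)))))

  e-occurrence : ∀ u → e (occurrence u) ≡ u
  e-occurrence u =
    trans (proj₁ (proj₂ (proj₂ (first (proj₁ (occurs u)))))) (proj₂ (occurs u))

  occurrence-unique : ∀ {m u} → ¬ Repeat m → e m ≡ u → occurrence u ≡ m
  occurrence-unique {m} {u} new em≡u =
    first-unique (occurrence-new u) new (trans (e-occurrence u) (sym em≡u))

  rank-occurrence : ∀ m → rank (occurrence (e m)) ≤ m
  rank-occurrence m =
    let (l , l≤m , el≡em , new) = first m
    in ℕ.≤-trans (ℕ.≤-reflexive (cong rank (occurrence-unique new el≡em)))
         (ℕ.≤-trans (rank≤ l) l≤m)

  rank-of : U → ℕ
  rank-of u = rank (occurrence u)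

  rank-of-injective : ∀ {u v} → rank-of u ≡ rank-of v → u ≡ v
  rank-of-injective {u} {v} eq = trans (sym (e-occurrence u))
    (trans (cong e (rank-injective (occurrence-new u) (occurrence-new v) eq)) (e-occurrence v))

  at : ∀ u {i} → i ≤ rank-of u → ∃ λ v → rank-of v ≡ i
  at u {i} i≤r =
    let (m , new , r≡i) = rank-surjective (suc (occurrence u))
          (ℕ.≤-<-trans i≤r (rank-mono-< (occurrence-new u) ℕ.≤-refl))
    in e m , trans (cong rank (occurrence-unique new refl)) r≡i

  -- Elements of ranks 0, ..., `rank-of u` exist and are distinct, so they occupy that many
  -- positions of `s`.
  rank<size : ∀ u → suc (rank-of u) ≤ˢ s
  rank<size u = injection⇒≤ˢ s (λ j → C.to (element j)) λ {i} {j} eq →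
    Fin.toℕ-injective (trans (sym (proj₂ (below i)))
      (trans (cong rank-of (to-injective countable eq)) (proj₂ (below j))))
    where
    below : (j : Fin (suc (rank-of u))) → ∃ λ v → rank-of v ≡ Fin.toℕ j
    below j = at u (Fin.toℕ≤pred[n] j)
    element : Fin (suc (rank-of u)) → U
    element j = proj₁ (below j)

  private
    module _ {i} (i<s : suc i ≤ˢ s) where

      j<s : (j : Fin (suc i)) → suc (Fin.toℕ j) ≤ˢ s
      j<s j = ≤-≤ˢ-trans s (Fin.toℕ<n j) i<s

      element : Fin (suc i) → U
      element j = C.from (position s (Fin.toℕ j) (j<s j))

      element-injective : Injective _≡_ _≡_ element
      element-injective {j} {k} eq = Fin.toℕ-injective
        (trans (sym (index-position s (Fin.toℕ j) (j<s j)))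
          (trans (cong (index s) (from-injective countable eq))
            (index-position s (Fin.toℕ k) (j<s k))))

  -- By the pigeonhole principle one of i + 1 elements has rank at least i.
  reach : ∀ i → suc i ≤ˢ s → ∃ λ v → rank-of v ≡ i
  reach i i<s with Fin.any? (λ j → i ℕ.≤? rank-of (element i<s j))
  ... | yes (j , i≤r) = at _ i≤r
  ... | no  none = contradiction (Fin.injective⇒≤ {f = code} code-injective) (ℕ.<⇒≱ ℕ.≤-refl)
    where
    small : ∀ j → rank-of (element i<s j) < i
    small j = ℕ.≰⇒> (λ i≤r → none (j , i≤r))
    code : Fin (suc i) → Fin i
    code j = Fin.fromℕ< (small j)
    code-injective : Injective _≡_ _≡_ code
    code-injective {j} {k} eq = element-injective i<s
      (rank-of-injective (Fin.fromℕ<-injective _ _ (small j) (small k) eq))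

  abstract
    order : Position s ↔ U
    order = mk↔ₛ′
      (λ p → proj₁ (reach (index s p) (index<size s p)))
      (λ u → position s (rank-of u) (rank<size u))
      (λ u → rank-of-injective (trans (proj₂ (reach _ _)) (index-position s (rank-of u) (rank<size u))))
      (λ p → index-injective s (trans (index-position s _ (rank<size _)) (proj₂ (reach _ _))))

    -- Deleting repetitions only moves elements forward. Hence the first k elements of the order
    -- contain the first k entries of the stream.
    order-index : ∀ m → index s (Inverse.from order (e m)) ≤ m
    order-index m = ℕ.≤-trans (ℕ.≤-reflexive (index-position s _ (rank<size (e m)))) (rank-occurrence m)

-- Concatenation of blocks into a stream

start : (ℕ → ℕ) → ℕ → ℕ
start len zero    = 0
start len (suc i) = start len i + len i

module Concatenation {U : Set} (len : ℕ → ℕ) (0<len : ∀ i → 0 < len i) (b : ℕ → ℕ → U) where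

  next : ℕ × ℕ → ℕ × ℕ
  next (i , l) with suc l ℕ.<? len i
  ... | yes _ = i , suc l
  ... | no  _ = suc i , 0

  place : ℕ → ℕ × ℕ
  place zero    = 0 , 0
  place (suc m) = next (place m)

  concatenation : ℕ → U
  concatenation m = let (i , l) = place m in b i l

  next-suc : ∀ i l → suc l < len i → next (i , l) ≡ (i , suc l)
  next-suc i l l< with suc l ℕ.<? len i
  ... | yes _ = refl
  ... | no ¬p = contradiction l< ¬p

  next-zero : ∀ i l → suc l ≡ len i → next (i , l) ≡ (suc i , 0)
  next-zero i l eq with suc l ℕ.<? len i
  ... | yes p = contradiction eq (ℕ.<⇒≢ p)
  ... | no  _ = refl

  place-start : ∀ i l → l < len i → place (start len i + l) ≡ (i , l)
  place-start zero    zero    _  = refl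
  -- The position before the start of a block is the last one of the preceding block, which exists
  -- because blocks are non-empty.
  place-start (suc i) zero    _
    with len i in eq | 0<len i
  ... | suc n | _
    rewrite ℕ.+-identityʳ (start len i + suc n) | ℕ.+-suc (start len i) n
          | place-start i n (ℕ.≤-reflexive (sym eq)) = next-zero i n (sym eq)
  place-start i       (suc l) l<
    rewrite ℕ.+-suc (start len i) l | place-start i l (ℕ.<⇒≤ l<) = next-suc i l l<

  concatenation-start : ∀ i l → l < len i → concatenation (start len i + l) ≡ b i l
  concatenation-start i l l< rewrite place-start i l l< = refl

-- Accountability

T-not⁺ : ∀ {P : Set} (d : Dec P) → ¬ P → T (not ⌊ d ⌋)
T-not⁺ (yes p) ¬p = contradiction p ¬p
T-not⁺ (no _)  _  = tt

T-not⁻ : ∀ {P : Set} (d : Dec P) → T (not ⌊ d ⌋) → ¬ P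
T-not⁻ (no ¬p) _ = ¬p

module _ (I : Instance) where

  open Instance I

  value-mono : ∀ {X Y} → X ⊆ Y → f X ≼ f Y
  value-mono {X} {Y} X⊆Y = ⟪ monotone X Y X⊆Y ⟫

  0≼value : ∀ X → 0ᴿ ≼ f X
  0≼value X = ⟪ nonNegative X ⟫

  firstElements⁺ : ∀ σ {k u} → index size (Inverse.from σ u) < k → u ∈ firstElements σ k
  firstElements⁺ σ = ℕ.<⇒<ᵇ

  firstElements-cardinality : ∀ σ {k} → k ≤ˢ size → HasCardinality (firstElements σ k) k
  firstElements-cardinality σ {k} k≤s = mk↔ₛ′
    (λ j → Inverse.to σ (pos j) , firstElements⁺ σ (subst (_< k) (sym (index-to j)) (Fin.toℕ<n j)))
    (λ (u , u∈) → Fin.fromℕ< (ℕ.<ᵇ⇒< _ _ u∈))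
    (λ (u , u∈) → ∃-≡ (trans
      (cong (Inverse.to σ) (index-injective size
        (trans (index-position size _ _) (Fin.toℕ-fromℕ< (ℕ.<ᵇ⇒< _ _ u∈)))))
      (Inverse.strictlyInverseˡ σ u)))
    (λ j → Fin.toℕ-injective (trans (Fin.toℕ-fromℕ< _) (index-to j)))
    where
    pos : Fin k → Position size
    pos j = position size (Fin.toℕ j) (≤-≤ˢ-trans size (Fin.toℕ<n j) k≤s)
    index-to : ∀ j → index size (Inverse.from σ (Inverse.to σ (pos j))) ≡ Fin.toℕ j
    index-to j = trans (cong (index size) (Inverse.strictlyInverseʳ σ (pos j)))
                       (index-position size _ _)

  remove-cardinality : ∀ {X m e} → e ∈ X → HasCardinality X (suc m) → HasCardinality (X ∖ e) m
  remove-cardinality {X} {m} {e} e∈X card = mk↔ₛ′ to′ from′ to∘from from∘to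
    where
    open Inverse card
    p : Fin (suc m)
    p = from (e , e∈X)
    keep : ∀ {u} → u ∈ X → u ≢ e → u ∈ X ∖ e
    keep {u} u∈X u≢e = Equivalence.from (Bool.T-∧ {X _}) (u∈X , T-not⁺ (u ≟ e) u≢e)
    kept : ∀ {u} → u ∈ X ∖ e → u ∈ X
    kept u∈ = proj₁ (Equivalence.to (Bool.T-∧ {X _}) u∈)
    kept-≢ : ∀ {u} → u ∈ X ∖ e → u ≢ e
    kept-≢ {u} u∈ = T-not⁻ (u ≟ e) (proj₂ (Equivalence.to (Bool.T-∧ {X u}) u∈))
    p≢from : ∀ {u} (u∈ : u ∈ X ∖ e) → p ≢ from (u , kept u∈)
    p≢from u∈ eq = kept-≢ u∈ (sym (cong proj₁ (from-injective card eq)))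
    to′ : Fin m → ∃ λ u → u ∈ X ∖ e
    to′ j = let (u , u∈X) = to (Fin.punchIn p j) in
      u , keep u∈X λ u≡e → Fin.punchInᵢ≢i p j
        (trans (sym (strictlyInverseʳ (Fin.punchIn p j))) (cong from (∃-≡ u≡e)))
    from′ : (∃ λ u → u ∈ X ∖ e) → Fin m
    from′ (u , u∈) = Fin.punchOut (p≢from u∈)
    to∘from : ∀ v → to′ (from′ v) ≡ v
    to∘from (u , u∈) = ∃-≡ (cong proj₁
      (trans (cong to (Fin.punchIn-punchOut (p≢from u∈))) (strictlyInverseˡ (u , kept u∈))))
    from∘to : ∀ j → from′ (to′ j) ≡ j
    from∘to j = trans
      (Fin.punchOut-cong p (trans (cong from (∃-≡ refl)) (strictlyInverseʳ (Fin.punchIn p j))))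
      (Fin.punchOut-punchIn p)

  -- Every prefix of length j has at least the share j / m of the value of X. Quantifying over all Z
  -- that contain the prefix makes the bound directly applicable to larger sets. Entries of x from m
  -- on are arbitrary.
  GreedyOrder : 𝒫 U → ℕ → Set
  GreedyOrder X m = ∃ λ (x : ℕ → U) →
    (∀ u → u ∈ X → ∃ λ l → l < m × x l ≡ u) ×
    (∀ j → j < m → ∀ Z → (∀ l → l < j → x l ∈ Z) → j · f X ≼ m · f Z)

  -- The remaining case j = m holds by monotonicity, since the full list covers X.
  prefix-value : ∀ {X m} (g : GreedyOrder X m) j → j ≤ m → ∀ Z →
    (∀ l → l < j → proj₁ g l ∈ Z) → j · f X ≼ m · f Z
  prefix-value {X} {m} (x , covers , value) j j≤m Z prefix⊆Z with ℕ.m≤n⇒m<n∨m≡n j≤m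
  ... | inj₁ j<m  = value j j<m Z prefix⊆Z
  ... | inj₂ refl = ·-monoʳ m (value-mono λ u u∈X →
    let (l , l<m , xl≡u) = covers u u∈X in subst (_∈ Z) xl≡u (prefix⊆Z l l<m))

  extend : ℕ → (ℕ → U) → U → ℕ → U
  extend m x e l with l ℕ.<? m
  ... | yes _ = x l
  ... | no  _ = e

  extend-< : ∀ {m} x e {l} → l < m → extend m x e l ≡ x l
  extend-< {m} x e {l} l<m with l ℕ.<? m
  ... | yes _   = refl
  ... | no  l≮m = contradiction l<m l≮m

  extend-≡ : ∀ m x e → extend m x e m ≡ e
  extend-≡ m x e with m ℕ.<? m
  ... | yes m<m = contradiction m<m (ℕ.n≮n m)
  ... | no  _   = refl

  abstract
    -- Accountability supplies an element whose removal keeps the share m / (m + 1). It is placed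
    -- last and the rest is ordered recursively; the shares j / m and m / (m + 1) multiply to j / (m
    -- + 1).
    greedyOrder : U → ∀ m X → HasCardinality X m → GreedyOrder X m
    greedyOrder u₀ zero X card =
        (λ _ → u₀)
      , (λ u u∈X → contradiction (Inverse.from card (u , u∈X)) Fin.¬Fin0)
      , λ _ ()
    greedyOrder u₀ (suc m) X card
      with accountable X m card
    ... | e , e∈X , loss
      with greedyOrder u₀ m (X ∖ e) (remove-cardinality e∈X card)
    ... | g@(x , covers , _) = extend m x e , covers′ , value′
      where
      covers′ : ∀ u → u ∈ X → ∃ λ l → l < suc m × extend m x e l ≡ u
      covers′ u u∈X with u ≟ e in eq
      ... | yes u≡e = m , ℕ.≤-refl , trans (extend-≡ m x e) (sym u≡e)
      ... | no  u≢e =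
        let (l , l<m , xl≡u) = covers u (Equivalence.from (Bool.T-∧ {X _}) (u∈X , T-not⁺ (u ≟ e) u≢e))
        in l , ℕ.m<n⇒m<1+n l<m , trans (extend-< x e l<m) xl≡u

      scaled : ∀ j → j ≤ m → ∀ Z → j · f (X ∖ e) ≼ m · f Z → j · f X ≼ suc m · f Z
      scaled zero    _   Z _ = ≼-trans (≋⇒≼ (0·≋0 (f X))) (0≼· (suc m) (0≼value Z))
      -- Here 1 ≤ j ≤ m, so the factor m is positive and can be cancelled.
      scaled j@(suc _) (s≤s {n = m′} _) Z p = ·-cancel m′ (begin
        m · j · f X             ∼⟨ ≋⇒≼ (·-swap m j (f X)) ⟩
        j · m · f X             ∼⟨ ·-monoʳ j (1-1/n m ⟪ loss ⟫) ⟩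
        j · suc m · f (X ∖ e)   ∼⟨ ≋⇒≼ (·-swap j (suc m) (f (X ∖ e))) ⟩
        suc m · j · f (X ∖ e)   ∼⟨ ·-monoʳ (suc m) p ⟩
        suc m · m · f Z         ∼⟨ ≋⇒≼ (·-swap (suc m) m (f Z)) ⟩
        m · suc m · f Z         ∎)
        where open ≼-Reasoning

      value′ : ∀ j → j < suc m → ∀ Z → (∀ l → l < j → extend m x e l ∈ Z) →
               j · f X ≼ suc m · f Z
      value′ j (s≤s j≤m) Z prefix⊆Z = scaled j j≤m Z (prefix-value g j j≤m Z λ l l<j →
        subst (_∈ Z) (extend-< x e (ℕ.<-≤-trans l<j j≤m)) (prefix⊆Z l l<j))

-- The order given by a schedule of phases

-- Every phase except the first has room for one more element.
lengths : (ℕ → ℕ) → ℕ → ℕ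
lengths c zero    = suc (c zero ∸ 1)
lengths c (suc i) = suc (c (suc i))

-- The cross-multiplied form of w / D ≤ min(k ∸ s, cᵢ) / max(cᵢ, k), where s is the start of phase
-- i: this phase alone secures the share w / D of Opt(k).
record Reaches (D : ℕ) (c : ℕ → ℕ) (k w : ℕ) : Set where
  constructor phase
  field
    i     : ℕ
    bound : w * (c i ⊔ k) ≤ D * ((k ∸ start (lengths c) i) ⊓ c i)

-- A capacity may exceed |U|, where no optimum exists. The result is then |U|, which bounds every
-- admissible k; otherwise the capacity is unchanged.
clip : ∀ s c → ∃ λ c′ → c′ ≤ˢ s × c′ ≤ c × (c′ ≡ c ⊎ (∀ k → k ≤ˢ s → k ≤ c′))
clip infinite   c = c , _ , ℕ.≤-refl , inj₁ refl
clip (finite n) c with ℕ.≤-total c n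
... | inj₁ c≤n = c , c≤n , ℕ.≤-refl , inj₁ refl
... | inj₂ n≤c = n , ℕ.≤-refl , n≤c , inj₂ λ k k≤n → k≤n

module _ (I : Instance) where

  open Instance I

  module Inhabited (u₀ : U) where

    enum : ℕ → U
    enum i with suc i ≤ˢ? size
    ... | yes i<s = Inverse.from countable (position size i i<s)
    -- Past the end of a finite U any element will do, since repetitions get deleted.
    ... | no  _   = u₀

    enum-index : ∀ u → enum (index size (Inverse.to countable u)) ≡ u
    enum-index u with suc (index size (Inverse.to countable u)) ≤ˢ? size
    ... | yes i<s = trans
      (cong (Inverse.from countable) (index-injective size (index-position size _ i<s)))
      (Inverse.strictlyInverseʳ countable u)
    ... | no  i≮s = contradiction (index<size size _) i≮s

    optimal : ∀ k → k ≤ˢ size → 𝒫 U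
    optimal k k≤s = proj₁ (optimum k k≤s)

    greedyOptimum : ∀ k (k≤s : k ≤ˢ size) → GreedyOrder I (optimal k k≤s) k
    greedyOptimum k k≤s =
      greedyOrder I u₀ k (optimal k k≤s) (proj₁ (proj₂ (optimum k k≤s)))

    Opt-upper : ∀ {c} (c≤s : c ≤ˢ size) Y → HasCardinality Y c → f Y ≼ Opt c c≤s
    Opt-upper {c} c≤s Y card = ⟪ proj₂ (proj₂ (optimum c c≤s)) Y card ⟫

    -- Continue a greedy order of the optimal k-set by an enumeration of U and delete repetitions.
    -- The first c elements form a c-set that contains the first min(c, k) elements of the greedy
    -- order. For k ≤ c this makes Opt non-decreasing, for c ≤ k it makes Opt(k) / k non-increasing.
    Opt-scaling : ∀ {k c} (k≤s : k ≤ˢ size) (c≤s : c ≤ˢ size) →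
                  (c ⊓ k) · Opt k k≤s ≼ k · Opt c c≤s
    Opt-scaling {k} {c} k≤s c≤s = begin
      (c ⊓ k) · Opt k k≤s            ∼⟨ prefix-value I {optimal k k≤s} {k} g (c ⊓ k) (ℕ.m⊓n≤n c k) Y prefix⊆Y ⟩
      k · f Y                        ∼⟨ ·-monoʳ k (Opt-upper c≤s Y (firstElements-cardinality I σ c≤s)) ⟩
      k · Opt c c≤s                  ∎
      where
      open ≼-Reasoning
      g : GreedyOrder I (optimal k k≤s) k
      g = greedyOptimum k k≤s
      x : ℕ → U
      x = proj₁ g
      e : ℕ → U
      e m with m ℕ.<? k
      ... | yes _ = x m
      ... | no  _ = enum (m ∸ k)
      e-< : ∀ {l} → l < k → e l ≡ x l
      e-< {l} l<k with l ℕ.<? k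
      ... | yes _   = refl
      ... | no  l≮k = contradiction l<k l≮k
      e-≥ : ∀ i → e (k + i) ≡ enum i
      e-≥ i with k + i ℕ.<? k
      ... | yes k+i<k = contradiction k+i<k (ℕ.m+n≮m k i)
      ... | no  _     = cong enum (ℕ.m+n∸m≡n k i)
      open StreamOrder size countable _≟_ e
        (λ u → k + index size (Inverse.to countable u) , trans (e-≥ _) (enum-index u))
        renaming (order to σ; order-index to σ-index)
      Y : 𝒫 U
      Y = firstElements σ c
      prefix⊆Y : ∀ l → l < c ⊓ k → x l ∈ Y
      prefix⊆Y l l< = firstElements⁺ I σ (subst (λ u → index size (Inverse.from σ u) < c)
        (e-< (ℕ.<-≤-trans l< (ℕ.m⊓n≤n c k)))
        (ℕ.≤-<-trans (σ-index l) (ℕ.<-≤-trans l< (ℕ.m⊓n≤m c k))))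

    Opt-mono : ∀ {k c} (k≤s : suc k ≤ˢ size) (c≤s : c ≤ˢ size) → suc k ≤ c →
               Opt (suc k) k≤s ≼ Opt c c≤s
    Opt-mono {k} {c} k≤s c≤s k≤c = ·-cancel k
      (subst (λ j → j · Opt (suc k) k≤s ≼ suc k · Opt c c≤s) (ℕ.m≥n⇒m⊓n≡n k≤c)
        (Opt-scaling k≤s c≤s))

    module Schedule (c : ℕ → ℕ) where

      -- Phase 0 has length max(1, `c 0`), so it is non-empty even if its capacity is 0.
      0<lengths : ∀ i → 0 < lengths c i
      0<lengths zero    = s≤s z≤n
      0<lengths (suc i) = s≤s z≤n

      c≤lengths : ∀ i → c i ≤ lengths c i
      c≤lengths zero    = ℕ.m≤n+m∸n (c zero) 1
      c≤lengths (suc i) = ℕ.n≤1+n _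

      clipped : ℕ → ℕ
      clipped i = proj₁ (clip size (c i))

      clipped≤size : ∀ i → clipped i ≤ˢ size
      clipped≤size i = proj₁ (proj₂ (clip size (c i)))

      clipped≤c : ∀ i → clipped i ≤ c i
      clipped≤c i = proj₁ (proj₂ (proj₂ (clip size (c i))))

      chosen : ∀ i → GreedyOrder I (optimal (clipped i) (clipped≤size i)) (clipped i)
      chosen i = greedyOptimum (clipped i) (clipped≤size i)

      -- The element of U added after the i-th optimum makes the order exhaust U.
      filler : ℕ → U
      filler zero    = u₀
      filler (suc i) = enum i

      -- Places freed by clipping are padded with the filler, so the starts of the phases depend on
      -- `c` alone.
      block : ℕ → ℕ → U
      block i l with l ℕ.<? clipped i
      ... | yes _ = proj₁ (chosen i) l
      ... | no  _ = filler i

      block-< : ∀ i {l} → l < clipped i → block i l ≡ proj₁ (chosen i) l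
      block-< i {l} l< with l ℕ.<? clipped i
      ... | yes _   = refl
      ... | no  l≮ = contradiction l< l≮

      block-≥ : ∀ i {l} → clipped i ≤ l → block i l ≡ filler i
      block-≥ i {l} ≤l with l ℕ.<? clipped i
      ... | yes l<  = contradiction ≤l (ℕ.<⇒≱ l<)
      ... | no  _   = refl

      open Concatenation (lengths c) 0<lengths block

      occurs : ∀ u → ∃ λ m → concatenation m ≡ u
      occurs u =
          -- The last place of phase `suc i` lies past the clipped optimum and therefore holds
          -- `enum i`.
          start (lengths c) (suc i) + c (suc i)
        , trans (concatenation-start (suc i) (c (suc i)) ℕ.≤-refl)
            (trans (block-≥ (suc i) (clipped≤c (suc i))) (enum-index u))
        where i = index size (Inverse.to countable u)

      open StreamOrder size countable _≟_ concatenation occurs public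
        using (order; order-index)

      -- The first k entries of the stream include the first j entries of phase i, a prefix of the
      -- greedy order of its optimum; by `order-index` they are among the first k elements of the
      -- order.
      phase-value : ∀ k i → let j = (k ∸ start (lengths c) i) ⊓ clipped i in
        j · Opt (clipped i) (clipped≤size i) ≼ clipped i · f (firstElements order k)
      phase-value k i = prefix-value I (chosen i) _ (ℕ.m⊓n≤n (k ∸ s) (clipped i)) _ λ l l<j →
        let l<c = ℕ.<-≤-trans l<j (ℕ.m⊓n≤n (k ∸ s) (clipped i))
        in firstElements⁺ I order (subst (λ u → index size (Inverse.from order u) < k)
             (trans (concatenation-start i l
                      (ℕ.<-≤-trans l<c (ℕ.≤-trans (clipped≤c i) (c≤lengths i))))
                    (block-< i l<c))
             (ℕ.≤-<-trans (order-index (s + l))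
               (shift (ℕ.<-≤-trans l<j (ℕ.m⊓n≤m (k ∸ s) (clipped i))))))
        where
        s = start (lengths c) i
        shift : ∀ {l} → l < k ∸ s → s + l < k
        shift {l} l< = subst (s + l <_) (ℕ.m+[n∸m]≡n s≤k) (ℕ.+-monoʳ-< s l<)
          where
          s≤k : s ≤ k
          s≤k = ℕ.<⇒≤ (ℕ.m∸n≢0⇒n<m λ eq → ℕ.n≮0 (subst (l <_) eq l<))

      module _ (k i : ℕ) (k≤s : suc k ≤ˢ size) where

        private
          s  = start (lengths c) i
          c′ = clipped i
          c′≤s = clipped≤size i
          j  = (suc k ∸ s) ⊓ c i
          j′ = (suc k ∸ s) ⊓ c′
          Z  = firstElements order (suc k)

        open ≼-Reasoning

        -- The chosen optimum is worth at least Opt(k + 1) because Opt is non-decreasing. Clipping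
        -- does not lower the minimum, as k + 1 ∸ s ≤ k + 1 ≤ c′.
        phase-ratio-≥ : suc k ≤ c′ → j · Opt (suc k) k≤s ≼ (c i ⊔ suc k) · f Z
        phase-ratio-≥ k≤c′ = begin
          j · Opt (suc k) k≤s          ∼⟨ ·-monoʳ j (Opt-mono k≤s c′≤s k≤c′) ⟩
          j · Opt c′ c′≤s              ∼⟨ ·-monoˡ (0≼value I (optimal c′ c′≤s)) j≤j′ ⟩
          j′ · Opt c′ c′≤s             ∼⟨ phase-value (suc k) i ⟩
          c′ · f Z                     ∼⟨ ·-monoˡ (0≼value I Z)
                                           (ℕ.≤-trans (clipped≤c i) (ℕ.m≤m⊔n (c i) (suc k))) ⟩
          (c i ⊔ suc k) · f Z          ∎
          where
          j≤j′ : j ≤ j′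
          j≤j′ = ℕ.⊓-glb (ℕ.m⊓n≤m (suc k ∸ s) (c i))
            (ℕ.≤-trans (ℕ.m⊓n≤m (suc k ∸ s) (c i)) (ℕ.≤-trans (ℕ.m∸n≤m (suc k) s) k≤c′))

        -- The chosen optimum has at least the share cᵢ / (k + 1) of Opt(k + 1), and the prefix has
        -- the share j / cᵢ of that; cᵢ cancels.
        phase-ratio-≤ : c′ ≤ suc k → c′ ≡ c i → j · Opt (suc k) k≤s ≼ (c i ⊔ suc k) · f Z
        phase-ratio-≤ c′≤k c′≡c =
          ≼-trans (j·Opt≼k·f c′ c′≡c refl) (·-monoˡ (0≼value I Z) (ℕ.m≤n⊔m (c i) (suc k)))
          where
          -- The variable d stands for both `c i` and `c′`, so that the cases zero, where also j =
          -- 0, and positive can be split by matching.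
          j·Opt≼k·f : ∀ d → d ≡ c i → d ≡ c′ → j · Opt (suc k) k≤s ≼ suc k · f Z
          j·Opt≼k·f zero d≡c _ = begin
            j · Opt (suc k) k≤s   ∼⟨ ·-monoˡ (0≼value I (optimal (suc k) k≤s))
                                       (ℕ.≤-trans (ℕ.m⊓n≤n (suc k ∸ s) (c i)) (ℕ.≤-reflexive (sym d≡c))) ⟩
            0 · Opt (suc k) k≤s   ∼⟨ ≋⇒≼ (0·≋0 (Opt (suc k) k≤s)) ⟩
            0ᴿ                    ∼⟨ 0≼· (suc k) (0≼value I Z) ⟩
            suc k · f Z           ∎
          j·Opt≼k·f d@(suc d-1) d≡c d≡c′ = ·-cancel d-1 (begin
            d · j · Opt (suc k) k≤s    ∼⟨ ≋⇒≼ (·-swap d j (Opt (suc k) k≤s)) ⟩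
            j · d · Opt (suc k) k≤s    ∼⟨ ·-monoʳ j scaled ⟩
            j · suc k · Opt c′ c′≤s    ∼⟨ ≋⇒≼ (·-swap j (suc k) (Opt c′ c′≤s)) ⟩
            suc k · j · Opt c′ c′≤s    ∼⟨ ·-monoʳ (suc k) achieved ⟩
            suc k · d · f Z            ∼⟨ ≋⇒≼ (·-swap (suc k) d (f Z)) ⟩
            d · suc k · f Z            ∎)
            where
            scaled : d · Opt (suc k) k≤s ≼ suc k · Opt c′ c′≤s
            scaled = subst (λ n → n · Opt (suc k) k≤s ≼ suc k · Opt c′ c′≤s)
              (trans (ℕ.m≤n⇒m⊓n≡m c′≤k) (sym d≡c′)) (Opt-scaling k≤s c′≤s)
            achieved : j · Opt c′ c′≤s ≼ d · f Z
            achieved = subst (λ n → ((suc k ∸ s) ⊓ n) · Opt c′ c′≤s ≼ d · f Z) c′≡c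
              (subst (λ n → j′ · Opt c′ c′≤s ≼ n · f Z) (sym d≡c′) (phase-value (suc k) i))

        -- If clipping took effect, then c′ ≥ k + 1 and the first bound applies; otherwise
        -- `c′ ≡ c i` and either bound may apply.
        phase-ratio : j · Opt (suc k) k≤s ≼ (c i ⊔ suc k) · f Z
        phase-ratio with ℕ.≤-total (suc k) c′ | proj₂ (proj₂ (proj₂ (clip size (c i))))
        ... | inj₁ k≤c′ | _          = phase-ratio-≥ k≤c′
        ... | inj₂ _    | inj₂ all≤c′ = phase-ratio-≥ (all≤c′ (suc k) k≤s)
        ... | inj₂ c′≤k | inj₁ c′≡c  = phase-ratio-≤ c′≤k c′≡c

      reaches-value : ∀ {D k w} (k≤s : suc k ≤ˢ size) → Reaches D c (suc k) w →
                      w · Opt (suc k) k≤s ≼ D · f (firstElements order (suc k))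
      reaches-value {D} {k} {w} k≤s (phase i p) = cancel m 0<m (begin
        m · w · Opt (suc k) k≤s    ∼⟨ ≋⇒≼ (·-swap m w (Opt (suc k) k≤s)) ⟩
        w · m · Opt (suc k) k≤s    ∼⟨ ≋⇒≽ (·-assoc w m (Opt (suc k) k≤s)) ⟩
        (w * m) · Opt (suc k) k≤s  ∼⟨ ·-monoˡ (0≼value I (optimal (suc k) k≤s)) p ⟩
        (D * j) · Opt (suc k) k≤s  ∼⟨ ≋⇒≼ (·-assoc D j (Opt (suc k) k≤s)) ⟩
        D · j · Opt (suc k) k≤s    ∼⟨ ·-monoʳ D (phase-ratio k i k≤s) ⟩
        D · m · f Z                ∼⟨ ≋⇒≼ (·-swap D m (f Z)) ⟩
        m · D · f Z                ∎)
        where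
        open ≼-Reasoning
        m = c i ⊔ suc k
        j = (suc k ∸ start (lengths c) i) ⊓ c i
        Z = firstElements order (suc k)
        0<m : 0 < m
        0<m = ℕ.≤-trans (s≤s z≤n) (ℕ.m≤n⊔m (c i) (suc k))
        cancel : ∀ n {x y} → 0 < n → n · x ≼ n · y → x ≼ y
        cancel (suc n) _ = ·-cancel n

  -- For empty U every order will do, as there is no k with 1 ≤ k ≤ |U|.
  scheduleOrder : ∀ D c → ∃ λ (σ : Order) →
    ∀ {k w} (k≤s : suc k ≤ˢ size) → Reaches D c (suc k) w →
    w · Opt (suc k) k≤s ≼ D · f (firstElements σ (suc k))
  scheduleOrder D c with 1 ≤ˢ? size
  ... | yes 1≤s = order , reaches-value
    where
    open Inhabited (Inverse.from countable (position size 0 1≤s))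
    open Schedule c
  ... | no 1≰s  = ↔-sym countable , λ k≤s → contradiction (≤-≤ˢ-trans size (s≤s z≤n) k≤s) 1≰s

-- The certificate

scale : ℕ
scale = 10000

-- Approximately 125 · 5 ^ ((i + 0.6) / 9) for i = 0 , … , 8.
targets : List ℕ
targets = 139 ∷ 166 ∷ 198 ∷ 237 ∷ 284 ∷ 340 ∷ 406 ∷ 486 ∷ 581 ∷ []

-- A geometric sequence of ratio 5 with value g in phase 3. The earlier terms are rounded down; for
-- the targets the first lies between 1 and 4.
capacity : ℕ → ℕ → ℕ
capacity g 0                   = g ℕ./ 125
capacity g 1                   = g ℕ./ 25
capacity g 2                   = g ℕ./ 5
capacity g (suc (suc (suc n))) = g * 5 ^ n

phaseStart : ℕ → ℕ → ℕ
phaseStart g = start (lengths (capacity g))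

-- For 5ⁿ · lateStart g ≥ phaseStart g (3 + n) it is enough that
-- 4 · lateStart g > g.
lateStart : ℕ → ℕ
lateStart g = (g + 4) ℕ./ 4

-- ⌊ scale · min(a, c) / max(c, h + 1) ⌋; unlike _⊓_ and _⊔_, the operations _⊓′_
-- and _⊔′_ are evaluated by built-in comparisons.
share : (a c h : ℕ) → ℕ
share a c h = (scale * (a ⊓′ c)) ℕ./ suc ((c ∸ 1) ⊔′ h)

maximum : (ℕ → ℕ) → ℕ → ℕ
maximum w zero    = 0
maximum w (suc n) = maximum w n ⊔′ w n

total : (ℕ → ℕ) → List ℕ → ℕ
total w []       = 0
total w (g ∷ gs) = w g + total w gs

allBelow : (ℕ → Bool) → ℕ → Bool
allBelow P zero    = true
allBelow P (suc n) = P n ∧ allBelow P n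

-- For a whole interval of k, `largeShare` takes the numerator at the lower end y, with an upper
-- bound for the start of the phase, and the denominator at the upper end y + 1, all after division
-- by 5ʲ.
smallShare largeShare : ℕ → ℕ → ℕ → ℕ
smallShare h g i = share (suc h ∸ phaseStart g i) (capacity g i) h
largeShare y g i = share (y ∸ lateStart g * 5 ^ i) (g * 5 ^ i) y

-- smallWeight h is for k = h + 1, and largeWeight y for all j and k with
-- 5ʲ y ≤ k ≤ 5ʲ (y + 1), in the phases 3 + j , 4 + j and 5 + j.
smallWeight largeWeight : ℕ → ℕ → ℕ
smallWeight h g = maximum (smallShare h g) 5
largeWeight y g = maximum (largeShare y g) 3

-- Cleared of denominators: the mean of `w g / scale` over the targets is at least 1000 / 1772.
Enough : (ℕ → ℕ) → Set
Enough w = scale * (length targets * 1000) ≤ 1772 * total w targets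

enough : (ℕ → ℕ) → Bool
enough w = scale * (length targets * 1000) ≤ᵇ 1772 * total w targets

-- Soundness of the computed weights

allBelow-sound : ∀ P n → T (allBelow P n) → ∀ {i} → i < n → T (P i)
allBelow-sound P (suc n) p {i} i<1+n
  with Equivalence.to (Bool.T-∧ {P n}) p | ℕ.m≤n⇒m<n∨m≡n i<1+n
... | _ , ps | inj₁ (s≤s i<n) = allBelow-sound P n ps i<n
... | q , _  | inj₂ refl      = q

allBelow-enough : ∀ (w : ℕ → ℕ → ℕ) n → T (allBelow (λ i → enough (w i)) n) →
                  ∀ {i} → i < n → Enough (w i)
allBelow-enough w n p {i} i<n =
  ℕ.≤ᵇ⇒≤ (scale * (length targets * 1000)) (1772 * total (w i) targets)
    (allBelow-sound (λ i → enough (w i)) n p i<n)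

abstract
  -- Accepting `tt` makes the type checker evaluate all 499 inequalities; `abstract` prevents later
  -- evaluation of the proof.
  smallWeight-enough : ∀ {h} → h < 499 → Enough (smallWeight h)
  smallWeight-enough = allBelow-enough smallWeight 499 tt

  -- The values 500 + y run from 500 to 2499, one full factor of 5.
  largeWeight-enough : ∀ {y} → y < 2000 → Enough (largeWeight (500 + y))
  largeWeight-enough = allBelow-enough (λ y → largeWeight (500 + y)) 2000 tt

  starts-checked : All (λ g → phaseStart g 3 ≤ lateStart g) targets
  starts-checked = toWitness {a? = All.all? (λ g → phaseStart g 3 ℕ.≤? lateStart g) targets} tt

-- The divisor in `share` equals max(c, h + 1), written as a successor to be non-zero; a rounded
-- quotient times its divisor is at most the dividend.
share-bound : ∀ a c h → share a c h * (c ⊔ suc h) ≤ scale * (a ⊓ c)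
share-bound a c h = begin
  share a c h * (c ⊔ suc h)                ≤⟨ ℕ.*-monoʳ-≤ (share a c h) (ℕ.⊔-lub c≤d (s≤s h≤d)) ⟩
  share a c h * suc ((c ∸ 1) ⊔′ h)         ≤⟨ ℕ.m/n*n≤m (scale * (a ⊓′ c)) (suc ((c ∸ 1) ⊔′ h)) ⟩
  scale * (a ⊓′ c)                         ≡⟨ cong (scale *_) (sym (ℕ.⊓≡⊓′ a c)) ⟩
  scale * (a ⊓ c)                          ∎
  where
  open ℕ.≤-Reasoning
  h≤d : h ≤ (c ∸ 1) ⊔′ h
  h≤d = subst (h ≤_) (ℕ.⊔≡⊔′ (c ∸ 1) h) (ℕ.m≤n⊔m (c ∸ 1) h)
  c≤d : c ≤ suc ((c ∸ 1) ⊔′ h)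
  c≤d = ℕ.≤-trans (ℕ.m≤n+m∸n c 1)
    (s≤s (subst (c ∸ 1 ≤_) (ℕ.⊔≡⊔′ (c ∸ 1) h) (ℕ.m≤m⊔n (c ∸ 1) h)))

maximum-closed : ∀ (P : ℕ → Set) → P 0 → ∀ w n → (∀ i → P (w i)) → P (maximum w n)
maximum-closed P p₀ w zero    p = p₀
maximum-closed P p₀ w (suc n) p = subst P (ℕ.⊔≡⊔′ (maximum w n) (w n)) max
  where
  max : P (maximum w n ⊔ w n)
  max with ℕ.⊔-sel (maximum w n) (w n)
  ... | inj₁ eq = subst P (sym eq) (maximum-closed P p₀ w n p)
  ... | inj₂ eq = subst P (sym eq) (p n)

smallWeight-reaches : ∀ h g → Reaches scale (capacity g) (suc h) (smallWeight h g)
-- `phase 0 z≤n` is for the weight 0, the maximum of no shares. Five phases suffice for k < 500, as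
-- phase 4 has capacity at least 695 for every target.
smallWeight-reaches h g = maximum-closed (Reaches scale (capacity g) (suc h)) (phase 0 z≤n)
  (smallShare h g) 5
  λ i → phase i (share-bound (suc h ∸ phaseStart g i) (capacity g i) h)

g<4·lateStart : ∀ g → suc g ≤ lateStart g * 4
g<4·lateStart g = ℕ.+-cancelʳ-< 4 g (lateStart g * 4) (begin-strict
  g + 4                              ≡⟨ ℕ.m≡m%n+[m/n]*n (g + 4) 4 ⟩
  (g + 4) ℕ.% 4 + lateStart g * 4      <⟨ ℕ.+-monoˡ-< (lateStart g * 4) (ℕ.m%n<n (g + 4) 4) ⟩
  4 + lateStart g * 4                ≡⟨ ℕ.+-comm 4 (lateStart g * 4) ⟩
  lateStart g * 4 + 4                ∎)
  where open ℕ.≤-Reasoning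

-- With L = `lateStart g`, phase 3 + n adds g 5ⁿ + 1 ≤ (g + 1) 5ⁿ ≤ 4 L 5ⁿ elements, and L 5ⁿ + 4 L
-- 5ⁿ is the bound for the next phase.
phaseStart-bound : ∀ g → phaseStart g 3 ≤ lateStart g → ∀ n →
                   phaseStart g (3 + n) ≤ lateStart g * 5 ^ n
phaseStart-bound g base zero    = ℕ.≤-trans base (ℕ.≤-reflexive (sym (ℕ.*-identityʳ (lateStart g))))
phaseStart-bound g base (suc n) = begin
  phaseStart g (3 + n) + suc (g * 5 ^ n)        ≤⟨ ℕ.+-mono-≤ (phaseStart-bound g base n) (begin
    suc (g * 5 ^ n)                                 ≤⟨ ℕ.+-monoˡ-≤ (g * 5 ^ n) (ℕ.m^n>0 5 n) ⟩
    suc g * 5 ^ n                                   ≤⟨ ℕ.*-monoˡ-≤ (5 ^ n) (g<4·lateStart g) ⟩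
    lateStart g * 4 * 5 ^ n                         ∎) ⟩
  lateStart g * 5 ^ n + lateStart g * 4 * 5 ^ n ≡⟨ identity (lateStart g) (5 ^ n) ⟩
  lateStart g * (5 * 5 ^ n)                     ∎
  where
  open ℕ.≤-Reasoning
  identity : ∀ s p → s * p + s * 4 * p ≡ s * (5 * p)
  identity = solve-∀

module _ {j y k} (lower : 5 ^ j * y ≤ k) (upper : k ≤ 5 ^ j * suc y) where

  -- Phase 3 + i + j at k is compared with phase 3 + i at y: capacities scale by exactly 5ʲ and the
  -- bounds on the starts do too. The numerator uses `lower`, the denominator `upper`.
  largeShare-reaches : ∀ g → phaseStart g 3 ≤ lateStart g → ∀ i →
    Reaches scale (capacity g) k (largeShare y g i)
  largeShare-reaches g base i = phase (3 + (i + j)) (begin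
    w * (g * 5 ^ (i + j) ⊔ k)             ≤⟨ ℕ.*-monoʳ-≤ w (ℕ.⊔-mono-≤ (ℕ.≤-reflexive (split g)) upper) ⟩
    w * (5 ^ j * c ⊔ 5 ^ j * suc y)       ≡⟨ cong (w *_) (sym (ℕ.*-distribˡ-⊔ (5 ^ j) c (suc y))) ⟩
    w * (5 ^ j * (c ⊔ suc y))             ≡⟨ swap w (5 ^ j) (c ⊔ suc y) ⟩
    5 ^ j * (w * (c ⊔ suc y))             ≤⟨ ℕ.*-monoʳ-≤ (5 ^ j) (share-bound (y ∸ s) c y) ⟩
    5 ^ j * (scale * ((y ∸ s) ⊓ c))       ≡⟨ swap (5 ^ j) scale ((y ∸ s) ⊓ c) ⟩
    scale * (5 ^ j * ((y ∸ s) ⊓ c))       ≤⟨ ℕ.*-monoʳ-≤ scale (begin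
      5 ^ j * ((y ∸ s) ⊓ c)                  ≡⟨ ℕ.*-distribˡ-⊓ (5 ^ j) (y ∸ s) c ⟩
      (5 ^ j * (y ∸ s)) ⊓ (5 ^ j * c)           ≡⟨ cong₂ _⊓_ (ℕ.*-distribˡ-∸ (5 ^ j) y s) (sym (split g)) ⟩
      (5 ^ j * y ∸ 5 ^ j * s) ⊓ (g * 5 ^ (i + j))
        ≤⟨ ℕ.⊓-monoˡ-≤ (g * 5 ^ (i + j)) (ℕ.∸-mono lower
             (ℕ.≤-trans (phaseStart-bound g base (i + j)) (ℕ.≤-reflexive (split (lateStart g))))) ⟩
      (k ∸ phaseStart g (3 + (i + j))) ⊓ (g * 5 ^ (i + j)) ∎) ⟩
    scale * ((k ∸ phaseStart g (3 + (i + j))) ⊓ (g * 5 ^ (i + j))) ∎)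
    where
    open ℕ.≤-Reasoning
    s = lateStart g * 5 ^ i
    c = g * 5 ^ i
    w = share (y ∸ s) c y
    swap : ∀ a b x → a * (b * x) ≡ b * (a * x)
    swap = solve-∀
    split : ∀ a → a * 5 ^ (i + j) ≡ 5 ^ j * (a * 5 ^ i)
    split a = trans (cong (a *_) (ℕ.^-distribˡ-+-* 5 i j)) (rearrange a (5 ^ i) (5 ^ j))
      where
      rearrange : ∀ a p q → a * (p * q) ≡ q * (a * p)
      rearrange = solve-∀

  largeWeight-reaches : ∀ g → phaseStart g 3 ≤ lateStart g →
                        Reaches scale (capacity g) k (largeWeight y g)
  largeWeight-reaches g base = maximum-closed (Reaches scale (capacity g) k) (phase 0 z≤n)
    (largeShare y g) 3 (largeShare-reaches g base)

-- Divide by 5 until the quotient is below 5 b. The strict upper bound survives the rounding: m < x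
-- gives 5 (m + 1) ≤ 5 x, and k < 5 (m + 1) for m = ⌊k / 5⌋.
mantissa : ∀ b k → 0 < b → b ≤ k →
  ∃₂ λ j y → y < 4 * b × 5 ^ j * (b + y) ≤ k × k < 5 ^ j * suc (b + y)
mantissa b k 0<b = <-rec _ step k
  where
  step : ∀ k → (∀ {m} → m < k → b ≤ m →
           ∃₂ λ j y → y < 4 * b × 5 ^ j * (b + y) ≤ m × m < 5 ^ j * suc (b + y)) →
         b ≤ k → ∃₂ λ j y → y < 4 * b × 5 ^ j * (b + y) ≤ k × k < 5 ^ j * suc (b + y)
  step k rec b≤k with k ℕ.<? b + 4 * b
  ... | yes k<5b = 0 , k ∸ b
    , subst (k ∸ b <_) (ℕ.m+n∸m≡n b (4 * b)) (ℕ.∸-monoˡ-< k<5b b≤k)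
    , ℕ.≤-reflexive (trans (ℕ.*-identityˡ (b + (k ∸ b))) (ℕ.m+[n∸m]≡n b≤k))
    , subst (k <_) (sym (ℕ.*-identityˡ (suc (b + (k ∸ b)))))
        (s≤s (ℕ.≤-reflexive (sym (ℕ.m+[n∸m]≡n b≤k))))
  ... | no k≮5b =
    let instance k≢0 = ℕ.>-nonZero (ℕ.≤-trans 0<b b≤k)
        5b/5≡b = trans (cong (ℕ._/ 5) (ℕ.*-comm 5 b)) (ℕ.m*n/n≡m b 5)
        b≤k/5 = ℕ.≤-trans (ℕ.≤-reflexive (sym 5b/5≡b)) (ℕ./-monoˡ-≤ 5 (ℕ.≮⇒≥ k≮5b))
        (j , y , y< , lower , upper) = rec {k ℕ./ 5} (ℕ.m/n<m k 5 (s≤s (s≤s z≤n))) b≤k/5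
    in suc j , y , y<
     , (begin
         5 * 5 ^ j * (b + y)        ≡⟨ ℕ.*-assoc 5 (5 ^ j) (b + y) ⟩
         5 * (5 ^ j * (b + y))      ≤⟨ ℕ.*-monoʳ-≤ 5 lower ⟩
         5 * (k ℕ./ 5)                ≡⟨ ℕ.*-comm 5 (k ℕ./ 5) ⟩
         k ℕ./ 5 * 5                  ≤⟨ ℕ.m/n*n≤m k 5 ⟩
         k                          ∎)
     , (begin-strict
         k                          ≡⟨ ℕ.m≡m%n+[m/n]*n k 5 ⟩
         k ℕ.% 5 + k ℕ./ 5 * 5          <⟨ ℕ.+-monoˡ-< (k ℕ./ 5 * 5) (ℕ.m%n<n k 5) ⟩
         suc (k ℕ./ 5) * 5            ≡⟨ ℕ.*-comm (suc (k ℕ./ 5)) 5 ⟩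
         5 * suc (k ℕ./ 5)            ≤⟨ ℕ.*-monoʳ-≤ 5 upper ⟩
         5 * (5 ^ j * suc (b + y))  ≡⟨ sym (ℕ.*-assoc 5 (5 ^ j) (suc (b + y))) ⟩
         5 * 5 ^ j * suc (b + y)    ∎)
    where open ℕ.≤-Reasoning

Certificate : ℕ → Set
Certificate h = ∃ λ (w : ℕ → ℕ) →
  All (λ g → Reaches scale (capacity g) (suc h) (w g)) targets × Enough w

small-certificate : ∀ {h} → h < 499 → Certificate h
small-certificate {h} h<499 =
  smallWeight h , All.universal (smallWeight-reaches h) targets , smallWeight-enough h<499

large-certificate : ∀ {h} → 499 ≤ h → Certificate h
large-certificate {h} 499≤h =
  -- With b = 500 the range y < 4 b is the one covered by `largeWeight-enough`.
  let (j , y , y< , lower , upper) = mantissa 500 (suc h) (s≤s z≤n) (s≤s 499≤h)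
  in largeWeight (500 + y)
   , All.map (λ {g} base → largeWeight-reaches {j} lower (ℕ.<⇒≤ upper) g base) starts-checked
   , largeWeight-enough y<

certificate : ∀ h → Certificate h
certificate h = [ small-certificate , large-certificate ]′ (ℕ.<-≤-connex h 499)

-- The randomized solution

·-distribˡ-∑ : ∀ {A : Set} n as (h : A → ℝ) → n · ∑ as h ≋ ∑ as (λ a → n · h a)
·-distribˡ-∑ n []       h = ·0≋0 n
·-distribˡ-∑ n (a ∷ as) h = ≋-trans (·-distribˡ n (h a) (∑ as h))
  (+-cong-≋ {n · h a} {n · h a} {n · ∑ as h} {∑ as (λ a → n · h a)}
    ≋-refl (·-distribˡ-∑ n as h))

total-· : ∀ {A : Set} (σ : ℕ → A) (F : A → ℝ) {D O} w gs →
  All (λ g → w g · O ≼ D · F (σ g)) gs → total w gs · O ≼ D · ∑ (map σ gs) F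
total-· σ F {D} {O} w [] [] = ≼-trans (≋⇒≼ (0·≋0 O)) (≋⇒≽ (·0≋0 D))
total-· σ F {D} {O} w (g ∷ gs) (p ∷ ps) =
  ≼-trans (≋⇒≼ (·-distribʳ (w g) (total w gs) O)) (≼-trans
    (+-mono-≼ {w g · O} {D · F (σ g)} {total w gs · O} {D · ∑ (map σ gs) F}
      p (total-· σ F w gs ps))
    (≋⇒≽ (·-distribˡ D (F (σ g)) (∑ (map σ gs) F))))

module _ {Ω : Set} (a₀ : Ω) (as : List Ω) where

  open Uniform a₀ as

  length·mean : ∀ F → suc (length as) · mean F ≋ ∑ atoms F
  length·mean F = ≋-trans (·-distribˡ-∑ N atoms (λ a → F a *ᴿ fromℚ weight))
    (∑-cong atoms λ a → ≋-trans
      (·-monoʳ N (≋⇒≼ (*-comm-≋ (F a) (fromℚ weight))) , ·-monoʳ N (≋⇒≽ (*-comm-≋ (F a) (fromℚ weight))))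
      (n·1/n (length as) (F a)))
    where N = suc (length as)

  -- For D = d + 1 and N atoms, t O ≤ D N `mean F` while D N (q + 1) ≤ p t; multiply the first by p,
  -- the second by O, and cancel D N (q + 1).
  mean-bound : ∀ d p q t {O} F → 0ᴿ ≼ O →
    suc d * (suc (length as) * suc q) ≤ p * t →
    t · O ≼ suc d · ∑ atoms F → O ≼ fromℚ (+ p / suc q) *ᴿ mean F
  mean-bound d p q t {O} F 0≼O enough bound =
    ·-cancel q (·-cancel (length as) (·-cancel d (begin
      D · N · suc q · O           ∼⟨ ·-monoʳ D (≋⇒≽ (·-assoc N (suc q) O)) ⟩
      D · (N * suc q) · O         ∼⟨ ≋⇒≽ (·-assoc D (N * suc q) O) ⟩
      (D * (N * suc q)) · O       ∼⟨ ·-monoˡ 0≼O enough ⟩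
      (p * t) · O                 ∼⟨ ≋⇒≼ (·-assoc p t O) ⟩
      p · t · O                   ∼⟨ ·-monoʳ p bound ⟩
      p · D · ∑ atoms F           ∼⟨ ≋⇒≼ (·-swap p D (∑ atoms F)) ⟩
      D · p · ∑ atoms F           ∼⟨ ·-monoʳ D (·-monoʳ p (≋⇒≽ (length·mean F))) ⟩
      D · p · N · mean F          ∼⟨ ·-monoʳ D (≋⇒≼ (·-swap p N (mean F))) ⟩
      D · N · p · mean F          ∼⟨ ·-monoʳ D (·-monoʳ N (≋⇒≽ (m/n·n p q (mean F)))) ⟩
      D · N · suc q · (fromℚ (+ p / suc q) *ᴿ mean F) ∎)))
    where
    open ≼-Reasoning
    D = suc d
    N = suc (length as)

module _ (I : Instance) where

  open Instance I

  -- Equality of real values cannot be decided, but agreement of two orders on their first k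
  -- positions can, and it determines the value of the prefix. It serves as the equivalence for
  -- `isExpectation`.
  agree : ∀ k → k ≤ˢ size → Order → Order → Bool
  agree zero    _   σ τ = true
  agree (suc k) k<s σ τ =
    agree k (≤-≤ˢ-trans size (ℕ.n≤1+n k) k<s) σ τ
    ∧ ⌊ Inverse.to σ (position size k k<s) ≟ Inverse.to τ (position size k k<s) ⌋

  agree-refl : ∀ k k≤s σ → T (agree k k≤s σ σ)
  agree-refl zero    _   σ = tt
  agree-refl (suc k) k<s σ = Equivalence.from Bool.T-∧
    (agree-refl k _ σ , fromWitness refl)

  agree⇒≡ : ∀ k k≤s σ τ → T (agree k k≤s σ τ) →
            ∀ p → index size p < k → Inverse.to σ p ≡ Inverse.to τ p
  agree⇒≡ (suc k) k<s σ τ t p p<1+k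
    with Equivalence.to (Bool.T-∧ {agree k (≤-≤ˢ-trans size (ℕ.n≤1+n k) k<s) σ τ}) t
       | ℕ.m≤n⇒m<n∨m≡n p<1+k
  ... | ts , _ | inj₁ (s≤s p<k) = agree⇒≡ k _ σ τ ts p p<k
  ... | _ , e  | inj₂ p≡k       =
    subst (λ p → Inverse.to σ p ≡ Inverse.to τ p)
      (index-injective size (trans (index-position size k k<s) (sym (ℕ.suc-injective p≡k))))
      (toWitness e)

  ≡⇒firstElements-⊆ : ∀ k σ τ →
    (∀ p → index size p < k → Inverse.to σ p ≡ Inverse.to τ p) →
    firstElements σ k ⊆ firstElements τ k
  ≡⇒firstElements-⊆ k σ τ eq u u∈ = firstElements⁺ I τ (subst (λ p → index size p < k) (sym from≡) p<k)
    where
    p<k : index size (Inverse.from σ u) < k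
    p<k = ℕ.<ᵇ⇒< _ _ u∈
    from≡ : Inverse.from τ u ≡ Inverse.from σ u
    from≡ = trans (cong (Inverse.from τ)
      (trans (sym (Inverse.strictlyInverseˡ σ u)) (eq (Inverse.from σ u) p<k)))
      (Inverse.strictlyInverseʳ τ (Inverse.from σ u))

  prefixValue-cong : ∀ k k≤s σ τ → T (agree k k≤s σ τ) →
               f (firstElements τ k) ≋ f (firstElements σ k)
  prefixValue-cong k k≤s σ τ t =
      value-mono I (≡⇒firstElements-⊆ k τ σ (λ p p<k → sym (agree⇒≡ k k≤s σ τ t p p<k)))
    , value-mono I (≡⇒firstElements-⊆ k σ τ (agree⇒≡ k k≤s σ τ t))

  -- A set of cardinality 0 has no elements, so it is contained in every X.
  Opt-zero : ∀ 0≤s X → Opt 0 0≤s ≼ f X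
  Opt-zero 0≤s X = value-mono I λ u u∈ →
    contradiction (Inverse.from (proj₁ (proj₂ (optimum 0 0≤s))) (u , u∈)) λ ()

  orderFor : ℕ → Order
  orderFor g = proj₁ (scheduleOrder I scale (capacity g))

  -- 139 is the head of `targets`, so the atoms compute to `map orderFor targets`.
  open Uniform (orderFor 139) (map orderFor (List.drop 1 targets))

  solution : RandomizedSolution
  solution = record { distribution = uniform ; measurable = λ _ _ → tt }

  prefixValue : ℕ → Order → ℝ
  prefixValue k σ = f (firstElements σ k)

  weighted-bound : ∀ k (k≤s : k ≤ˢ size) w → Enough w →
    All (λ g → w g · Opt k k≤s ≼ scale · prefixValue k (orderFor g)) targets →
    Opt k k≤s ≼ fromℚ (+ 1772 / 1000) *ᴿ mean (prefixValue k)
  weighted-bound k k≤s w enough bounds =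
    -- 9999 and 999 are the predecessors of `scale` and of the denominator 1000.
    mean-bound (orderFor 139) (map orderFor (List.drop 1 targets)) 9999 1772 999
      (total w targets) (prefixValue k) (0≼value I (proj₁ (optimum k k≤s))) enough
      (total-· orderFor (prefixValue k) w targets bounds)

  competitive-bound : ∀ k (k≤s : k ≤ˢ size) →
    Opt k k≤s ≼ fromℚ (+ 1772 / 1000) *ᴿ mean (prefixValue k)
  -- For k = 0 each order attains the full optimum, hence the full weight `scale`.
  competitive-bound zero    0≤s = weighted-bound 0 0≤s (λ _ → scale)
    (toWitness {a? = scale * (length targets * 1000) ℕ.≤? 1772 * total (λ _ → scale) targets} tt)
    (All.universal (λ g → ·-monoʳ scale (Opt-zero 0≤s (firstElements (orderFor g) 0))) targets)
  competitive-bound (suc h) k≤s =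
    let (w , reaches , enough) = certificate h
    in weighted-bound (suc h) k≤s w enough
         (All.map (λ {g} → proj₂ (scheduleOrder I scale (capacity g)) k≤s) reaches)

  competitive : Competitive (fromℚ (+ 1772 / 1000)) solution
  competitive k k≤s =
      mean (prefixValue k)
    , isExpectation (agree k k≤s) (agree-refl k k≤s) (prefixValue k) (prefixValue-cong k k≤s)
    , ≼⇒≤ᴿ (competitive-bound k k≤s)

theorem5 : (I : Instance) →
    ∃ λ (S : Instance.RandomizedSolution I) →
    Instance.Competitive I (fromℚ (+ 1772 / 1000)) S
theorem5 I = solution I , competitive I
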